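{- Let $V$ be a finite-dimensional complex vector space with a Hermitian inner product and norm $\|\cdot\|$, let $\mathbf G$ be a finite group of unitary transformations of $V$, and let $\mathbf x_0\in V$ with $\|\mathbf x_0\|=1$ have full orbit under $\mathbf G$. Fix a subgroup sequence $\{I\}=\mathbf G_0<\mathbf G_1<\cdots<\mathbf G_m=\mathbf G$ and coset leader sets $\operatorname{CL}(\mathbf G_k/\mathbf G_{k-1})$, $1\le k\le m$. Then the subgroup decoding algorithm decodes correctly with some noise if and only if, for every $k$ with $0\le k<m$, every induced coset leader in $\operatorname{CL}(\mathbf G/\mathbf G_k)$ is minimal (as a coset representative of $\mathbf G_k$ in $\mathbf G$).
   Context: $\mathbf x_0$ has full orbit if $|\mathbf G\mathbf x_0|=|\mathbf G|$; $S=\operatorname{Stab}_{\mathbf G}(\mathbf x_0)$, and for a subgroup $H$, $\operatorname{Stab}_H(\mathbf x_0)=H\cap S$. Codewords are the vectors $g^{ -1}\mathbf x_0$, $g\in\mathbf G$. A set $\operatorname{CL}(\mathbf G_k/\mathbf G_{k-1})$ of coset leaders is a set of representatives of the left cosets $a\mathbf G_{k-1}$ of $\mathbf G_{k-1}$ in $\mathbf G_k$ containing $I$. For $k<l$ the induced coset leaders are $\operatorname{CL}(\mathbf G_l/\mathbf G_k)=\{c_l c_{l-1}\cdots c_{k+1}: c_i\in\operatorname{CL}(\mathbf G_i/\mathbf G_{i-1})\}$, a complete set of left coset representatives of $\mathbf G_k$ in $\mathbf G_l$. Subgroup decoding algorithm: given $\mathbf r\in V$, set $\mathbf r_0=\mathbf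 r$; for $k=1,\dots,m$ choose $d_k\in\operatorname{CL}(\mathbf G_k/\mathbf G_{k-1})$ minimizing $\|a\mathbf r_{k-1}-\mathbf x_0\|$ over $a\in\operatorname{CL}(\mathbf G_k/\mathbf G_{k-1})$ (ties broken by a fixed ordering) and set $\mathbf r_k=d_k\mathbf r_{k-1}$; output $g'=d_m\cdots d_1$. It decodes correctly with some noise if there is $\delta>0$ such that for all $g\in\mathbf G$ and $\mathbf r\in V$ with $\|\mathbf r-g^{ -1}\mathbf x_0\|<\delta$ the output lies in $Sg$. Fundamental region of a subgroup $H$: $\operatorname{FR}(H)=\{\mathbf x\in V:\|\mathbf x-\mathbf x_0\|<\|h\mathbf x-\mathbf x_0\|\text{ for all }h\in H\setminus\operatorname{Stab}_H(\mathbf x_0)\}$. For subgroups $H\le K$, a coset representative $c$ of $H$ in $K$ is minimal if $\mathbf x_0\in c(\operatorname{FR}(H))$. -}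

module Defs where

open import Algebra.Bundles using (AbelianGroup; CommutativeRing; Group)
open import Algebra.Module.Bundles using (LeftModule)
open import Algebra.Module.Morphism.Structures using (module LeftModuleMorphisms)
open import Algebra.Structures using (IsCommutativeRing)
import Algebra.Construct.DirectProduct as DirectProduct
import Algebra.Definitions.RawMonoid as RawMonoidOps
import Algebra.Module.Morphism.Construct.Composition as Comp
import Algebra.Module.Morphism.Construct.Identity as Id
import Algebra.Properties.Ring as RingProperties
import Algebra.Solver.Ring.NaturalCoefficients.Default as SemiringSolver
open import Data.Fin using (Fin)
open import Data.List.NonEmpty using (List⁺; foldr₁; toList)
open import Data.List.Relation.Unary.All using (All)
open import Data.List.Relation.Unary.Any using (Any)
open import Data.List.Relation.Unary.AllPairs using (AllPairs)
import Data.List.Membership.Setoid as SetoidMembership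
open import Data.Nat using (ℕ; zero; suc) renaming (_<_ to _<ℕ_)
open import Data.Product using (Σ; ∃; ∃-syntax; _×_; _,_; proj₁; proj₂)
open import Data.Vec.Functional using (Vector)
open import Function.Bundles using (Bijection)
open import Level using (Level; 0ℓ; _⊔_) renaming (suc to lsuc)
open import Relation.Binary.Bundles using (Setoid)
import Relation.Binary.Construct.NonStrictToStrict as ToStrict
import Relation.Binary.Construct.On as On
open import Relation.Binary.PropositionalEquality using (setoid)
open import Relation.Binary.Structures using (IsDecTotalOrder)
open import Relation.Nullary using (¬_; yes; no)
open import Relation.Unary using (Pred; _∈_; _∉_; _⊂_; _≐_)

-- The real numbers, axiomatised as a complete ordered field, which determines
-- them up to isomorphism.  Comparisons are decidable, as they are classically.

record Reals : Set₁ where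
  infix  4 _≈_ _≤_
  infixl 6 _+_
  infixl 7 _*_
  infix  8 -_
  field
    Carrier           : Set
    _≈_ _≤_           : Carrier → Carrier → Set
    _+_ _*_           : Carrier → Carrier → Carrier
    -_                : Carrier → Carrier
    0# 1#             : Carrier
    isCommutativeRing : IsCommutativeRing _≈_ _+_ _*_ -_ 0# 1#
    0≉1               : ¬ (0# ≈ 1#)
    inverse           : ∀ x → ¬ (x ≈ 0#) → ∃[ y ] x * y ≈ 1#
    isDecTotalOrder   : IsDecTotalOrder _≈_ _≤_
    +-monoˡ-≤         : ∀ z {x y} → x ≤ y → x + z ≤ y + z
    *-nonneg          : ∀ {x y} → 0# ≤ x → 0# ≤ y → 0# ≤ x * y
    supremum          : (P : Pred Carrier 0ℓ) → ∃ P →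
                        ∃[ b ] (∀ x → P x → x ≤ b) →
                        ∃[ s ] (∀ x → P x → x ≤ s) ×
                               (∀ b → (∀ x → P x → x ≤ b) → s ≤ b)

  open IsDecTotalOrder isDecTotalOrder public using (_≤?_)
  open ToStrict _≈_ _≤_ public using (_<_)

  commutativeRing : CommutativeRing 0ℓ 0ℓ
  commutativeRing = record { isCommutativeRing = isCommutativeRing }

-- Complex numbers as pairs (real part , imaginary part).

module Complex (ℝ : Reals) where
  open Reals ℝ
  open CommutativeRing commutativeRing
    using ( +-abelianGroup; +-cong; +-congˡ; +-congʳ; +-comm; +-identityʳ
          ; *-cong; *-congˡ; *-congʳ; *-comm; *-identityˡ; -‿cong; zeroˡ
          ; refl; sym; trans; ring; commutativeSemiring)
  open RingProperties ring using (-0#≈0#; -1*x≈-x)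

  ℂ : Set
  ℂ = Carrier × Carrier

  re im : ℂ → Carrier
  re = proj₁
  im = proj₂

  conj : ℂ → ℂ
  conj (a , b) = a , - b

  private
    additive : AbelianGroup 0ℓ 0ℓ
    additive = DirectProduct.abelianGroup +-abelianGroup +-abelianGroup

  open AbelianGroup additive public using () renaming (_≈_ to _≈ᶜ_; _∙_ to _+ᶜ_)

  infixl 7 _*ᶜ_
  _*ᶜ_ : ℂ → ℂ → ℂ
  (a , b) *ᶜ (c , d) = a * c + - (b * d) , a * d + b * c

  private
    open SemiringSolver commutativeSemiring using (solve; _:=_; _:+_; _:*_)

    -- The semiring solver sees - x as (- 1#) * x with - 1# an atom.
    neg : ∀ x → - x ≈ (- 1#) * x
    neg x = sym (-1*x≈-x x)

    *ᶜ-cong : ∀ {x y u v} → x ≈ᶜ y → u ≈ᶜ v → (x *ᶜ u) ≈ᶜ (y *ᶜ v)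
    *ᶜ-cong (p , q) (r , s) =
      +-cong (*-cong p r) (-‿cong (*-cong q s)) , +-cong (*-cong p s) (*-cong q r)

    *ᶜ-assoc : ∀ x y z → ((x *ᶜ y) *ᶜ z) ≈ᶜ (x *ᶜ (y *ᶜ z))
    *ᶜ-assoc (a , b) (c , d) (e , f) =
      trans (+-cong (*-congʳ (+-congˡ (neg _))) (neg _))
        (trans (solve 7 (λ a b c d e f n →
            ((a :* c :+ n :* (b :* d)) :* e :+ n :* ((a :* d :+ b :* c) :* f)) :=
            (a :* (c :* e :+ n :* (d :* f)) :+ n :* (b :* (c :* f :+ d :* e))))
            refl a b c d e f (- 1#))
          (sym (+-cong (*-congˡ (+-congˡ (neg _))) (neg _)))) ,
      trans (+-congʳ (*-congʳ (+-congˡ (neg _))))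
        (trans (solve 7 (λ a b c d e f n →
            ((a :* c :+ n :* (b :* d)) :* f :+ (a :* d :+ b :* c) :* e) :=
            (a :* (c :* f :+ d :* e) :+ b :* (c :* e :+ n :* (d :* f))))
            refl a b c d e f (- 1#))
          (sym (+-congˡ (*-congˡ (+-congˡ (neg _))))))

    *ᶜ-comm : ∀ x y → (x *ᶜ y) ≈ᶜ (y *ᶜ x)
    *ᶜ-comm (a , b) (c , d) =
      +-cong (*-comm a c) (-‿cong (*-comm b d)) ,
      trans (+-comm _ _) (+-cong (*-comm b c) (*-comm a d))

    *ᶜ-distribˡ : ∀ x y z → (x *ᶜ (y +ᶜ z)) ≈ᶜ ((x *ᶜ y) +ᶜ (x *ᶜ z))
    *ᶜ-distribˡ (a , b) (c , d) (e , f) =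
      trans (+-congˡ (neg _))
        (trans (solve 7 (λ a b c d e f n →
            (a :* (c :+ e) :+ n :* (b :* (d :+ f))) :=
            ((a :* c :+ n :* (b :* d)) :+ (a :* e :+ n :* (b :* f))))
            refl a b c d e f (- 1#))
          (sym (+-cong (+-congˡ (neg _)) (+-congˡ (neg _))))) ,
      solve 6 (λ a b c d e f →
        (a :* (d :+ f) :+ b :* (c :+ e)) :=
        ((a :* d :+ b :* c) :+ (a :* f :+ b :* e)))
        refl a b c d e f

    *ᶜ-identityˡ : ∀ x → ((1# , 0#) *ᶜ x) ≈ᶜ x
    *ᶜ-identityˡ (a , b) =
      trans (+-cong (*-identityˡ a) (trans (-‿cong (zeroˡ b)) -0#≈0#)) (+-identityʳ a) ,
      trans (+-cong (*-identityˡ b) (zeroˡ a)) (+-identityʳ b)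

    module A = AbelianGroup additive

    *ᶜ-identityʳ : ∀ x → (x *ᶜ (1# , 0#)) ≈ᶜ x
    *ᶜ-identityʳ x = A.trans (*ᶜ-comm x (1# , 0#)) (*ᶜ-identityˡ x)

    *ᶜ-distribʳ : ∀ x y z → ((y +ᶜ z) *ᶜ x) ≈ᶜ ((y *ᶜ x) +ᶜ (z *ᶜ x))
    *ᶜ-distribʳ x y z = A.trans (*ᶜ-comm (y +ᶜ z) x)
      (A.trans (*ᶜ-distribˡ x y z) (A.∙-cong (*ᶜ-comm x y) (*ᶜ-comm x z)))

  complexRing : CommutativeRing 0ℓ 0ℓ
  complexRing = record
    { Carrier = ℂ ; _≈_ = _≈ᶜ_ ; _+_ = _+ᶜ_ ; _*_ = _*ᶜ_
    ; -_ = A._⁻¹ ; 0# = A.ε ; 1# = 1# , 0#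
    ; isCommutativeRing = record
      { isRing = record
        { +-isAbelianGroup = A.isAbelianGroup
        ; *-cong     = *ᶜ-cong
        ; *-assoc    = *ᶜ-assoc
        ; *-identity = *ᶜ-identityˡ , *ᶜ-identityʳ
        ; distrib    = *ᶜ-distribˡ , *ᶜ-distribʳ
        }
      ; *-comm = *ᶜ-comm
      }
    }

-- The fields `‖‖-nonneg` and `‖‖-square` say ‖ x ‖ = √⟨ x , x ⟩, so the norm is
-- determined by the inner product.

record HermitianSpace (ℝ : Reals) m ℓ : Set (lsuc (m ⊔ ℓ)) where
  open Reals ℝ using (_≈_; _≤_; _*_; 0#) renaming (Carrier to R)
  open Complex ℝ
  field
    leftModule : LeftModule (CommutativeRing.ring complexRing) m ℓ

  open LeftModule leftModule public renaming (Carrierᴹ to Vec)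

  infixl 6 _-ᵛ_
  _-ᵛ_ : Vec → Vec → Vec
  x -ᵛ y = x +ᴹ (-ᴹ y)

  field
    finiteDimensional : ∃[ n ] Σ (Vector Vec n) λ b →
                        ∀ x → Σ (Vector ℂ n) λ c →
                        x ≈ᴹ RawMonoidOps.sum +ᴹ-rawMonoid (λ i → c i *ₗ b i)
    ⟨_,_⟩             : Vec → Vec → ℂ
    ⟨,⟩-cong          : ∀ {x x′ y y′} → x ≈ᴹ x′ → y ≈ᴹ y′ → ⟨ x , y ⟩ ≈ᶜ ⟨ x′ , y′ ⟩
    ⟨,⟩-+ˡ            : ∀ x y z → ⟨ x +ᴹ y , z ⟩ ≈ᶜ (⟨ x , z ⟩ +ᶜ ⟨ y , z ⟩)
    ⟨,⟩-*ˡ            : ∀ c x y → ⟨ c *ₗ x , y ⟩ ≈ᶜ (c *ᶜ ⟨ x , y ⟩)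
    ⟨,⟩-conj          : ∀ x y → ⟨ x , y ⟩ ≈ᶜ conj ⟨ y , x ⟩
    ⟨,⟩-nonneg        : ∀ x → 0# ≤ re ⟨ x , x ⟩
    ⟨,⟩-definite      : ∀ x → re ⟨ x , x ⟩ ≈ 0# → x ≈ᴹ 0ᴹ
    ‖_‖               : Vec → R
    ‖‖-nonneg         : ∀ x → 0# ≤ ‖ x ‖
    ‖‖-square         : ∀ x → ‖ x ‖ * ‖ x ‖ ≈ re ⟨ x , x ⟩

module _ {a ℓ} (S : Setoid a ℓ) where
  open Setoid S

  -- The subset P of S, with the equality of S, has exactly n elements.
  HasCardinality : ∀ {p} → Pred Carrier p → ℕ → Set (a ⊔ ℓ ⊔ p)
  HasCardinality P n = Bijection (setoid (Fin n)) (On.setoid {B = ∃ P} S proj₁)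

module Subgroups {c ℓ} (𝒢 : Group c ℓ) where
  open Group 𝒢
  open SetoidMembership (Group.setoid 𝒢) using () renaming (_∈_ to _∈ˡ_)

  record Subgroup p : Set (c ⊔ ℓ ⊔ lsuc p) where
    field
      member    : Pred Carrier p
      resp-≈    : ∀ {g h} → g ≈ h → g ∈ member → h ∈ member
      ε-closed  : ε ∈ member
      ∙-closed  : ∀ {g h} → g ∈ member → h ∈ member → (g ∙ h) ∈ member
      ⁻¹-closed : ∀ {g} → g ∈ member → (g ⁻¹) ∈ member

  open Subgroup public using (member)

  IsFinite : ∀ {p} → Subgroup p → Set (c ⊔ ℓ ⊔ p)
  IsFinite H = ∃[ n ] HasCardinality (Group.setoid 𝒢) (member H) n

  LeftCoset : ∀ {p} → Carrier → Pred Carrier p → Pred Carrier (c ⊔ ℓ ⊔ p)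
  LeftCoset a H g = ∃[ h ] h ∈ H × g ≈ a ∙ h

  RightCoset : ∀ {p} → Pred Carrier p → Carrier → Pred Carrier (c ⊔ ℓ ⊔ p)
  RightCoset H a g = ∃[ h ] h ∈ H × g ≈ h ∙ a

  -- The entries of `as` represent each left coset of H in K exactly once.  The
  -- order of the list is the fixed ordering used to break ties when decoding.
  record IsCosetLeaders {p} (K H : Subgroup p) (as : List⁺ Carrier) : Set (c ⊔ ℓ ⊔ p) where
    field
      in-K     : All (_∈ member K) (toList as)
      complete : ∀ g → g ∈ member K → Any (λ a → g ∈ LeftCoset a (member H)) (toList as)
      distinct : AllPairs (λ a b → b ∉ LeftCoset a (member H)) (toList as)
      has-ε    : ε ∈ˡ toList as

  -- {I} = 𝐆 0 < 𝐆 1 < … < 𝐆 m = G, with leaders k = CL(𝐆 (k + 1) / 𝐆 k).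
  -- Only 𝐆 0, …, 𝐆 m and leaders 0, …, leaders (m - 1) are constrained; the
  -- later entries are never used.
  record SubgroupSequence {p} (G : Subgroup p) (m : ℕ) : Set (c ⊔ ℓ ⊔ lsuc p) where
    field
      𝐆         : ℕ → Subgroup p
      bottom    : member (𝐆 0) ≐ (_≈ ε)
      strict    : ∀ k → k <ℕ m → member (𝐆 k) ⊂ member (𝐆 (suc k))
      top       : member (𝐆 m) ≐ member G
      leaders   : ℕ → List⁺ Carrier
      isLeaders : ∀ k → k <ℕ m → IsCosetLeaders (𝐆 (suc k)) (𝐆 k) (leaders k)

    -- InducedLeader k l is CL(𝐆 l / 𝐆 k) for k < l: the products c_l ⋯ c_{k+1}
    -- with c_i ∈ CL(𝐆 i / 𝐆 (i - 1)).
    data InducedLeader (k : ℕ) : ℕ → Pred Carrier (c ⊔ ℓ) where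
      first : ∀ {a} → a ∈ˡ toList (leaders k) → a ∈ InducedLeader k (suc k)
      next  : ∀ {l a c} → a ∈ˡ toList (leaders l) → c ∈ InducedLeader k l →
              (a ∙ c) ∈ InducedLeader k (suc l)

module Decoding {ℝ : Reals} {m ℓ} (V : HermitianSpace ℝ m ℓ) where
  open Reals ℝ using (_<_; _≤?_; 0#) renaming (Carrier to R)
  open Complex ℝ using (_≈ᶜ_)
  open HermitianSpace V
  open LeftModuleMorphisms rawLeftModule rawLeftModule

  vectors : Setoid m ℓ
  vectors = record { isEquivalence = ≈ᴹ-isEquivalence }

  record Unitary : Set (m ⊔ ℓ) where
    field
      ⟦_⟧           : Vec → Vec
      isIsomorphism : IsLeftModuleIsomorphism ⟦_⟧
      isometric     : ∀ x y → ⟨ ⟦ x ⟧ , ⟦ y ⟧ ⟩ ≈ᶜ ⟨ x , y ⟩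

  infixr 8 _·_
  _·_ : Unitary → Vec → Vec
  g · x = Unitary.⟦ g ⟧ x

  private
    module C = CommutativeRing (Complex.complexRing ℝ)

    identity : Unitary
    identity = record
      { ⟦_⟧           = λ x → x
      ; isIsomorphism = Id.isLeftModuleIsomorphism rawLeftModule ≈ᴹ-refl
      ; isometric     = λ _ _ → C.refl
      }

    compose : Unitary → Unitary → Unitary
    compose g h = record
      { ⟦_⟧           = λ x → g · h · x
      ; isIsomorphism = Comp.isLeftModuleIsomorphism ≈ᴹ-trans H.isIsomorphism G.isIsomorphism
      ; isometric     = λ x y → C.trans (G.isometric (h · x) (h · y)) (H.isometric x y)
      }
      where
      module G = Unitary g
      module H = Unitary h

    ·-cong : ∀ g {x y} → x ≈ᴹ y → g · x ≈ᴹ g · y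
    ·-cong g = IsLeftModuleIsomorphism.⟦⟧-cong (Unitary.isIsomorphism g)

    module Inverse (g : Unitary) where
      open Unitary g
      open IsLeftModuleIsomorphism isIsomorphism

      from : Vec → Vec
      from y = proj₁ (surjective y)

      to-from : ∀ y → ⟦ from y ⟧ ≈ᴹ y
      to-from y = proj₂ (surjective y) ≈ᴹ-refl

      to⇒from : ∀ {x y} → ⟦ x ⟧ ≈ᴹ y → from y ≈ᴹ x
      to⇒from e = injective (≈ᴹ-trans (to-from _) (≈ᴹ-sym e))

      from-cong : ∀ {x y} → x ≈ᴹ y → from x ≈ᴹ from y
      from-cong e = to⇒from (≈ᴹ-trans (to-from _) (≈ᴹ-sym e))

    inverse : Unitary → Unitary
    inverse g = record
      { ⟦_⟧           = from
      ; isIsomorphism = record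
        { isLeftModuleMonomorphism = record
          { isLeftModuleHomomorphism = record
            { +ᴹ-isGroupHomomorphism = record
              { isMonoidHomomorphism = record
                { isMagmaHomomorphism = record
                  { isRelHomomorphism = record { cong = from-cong }
                  ; homo = λ x y → to⇒from
                      (≈ᴹ-trans (+ᴹ-homo (from x) (from y)) (+ᴹ-cong (to-from x) (to-from y)))
                  }
                ; ε-homo = to⇒from 0ᴹ-homo
                }
              ; ⁻¹-homo = λ x → to⇒from (≈ᴹ-trans (-ᴹ-homo (from x)) (-ᴹ‿cong (to-from x)))
              }
            ; *ₗ-homo = λ c x → to⇒from
                (≈ᴹ-trans (*ₗ-homo c (from x)) (*ₗ-cong C.refl (to-from x)))
            }
          ; injective = λ {x} {y} e →
              ≈ᴹ-trans (≈ᴹ-sym (to-from x)) (≈ᴹ-trans (·-cong g e) (to-from y))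
          }
        ; surjective = λ x → g · x , λ e → to⇒from (≈ᴹ-sym e)
        }
      ; isometric     = λ x y → C.trans (C.sym (isometric (from x) (from y)))
                                        (⟨,⟩-cong (to-from x) (to-from y))
      }
      where
      open Inverse g
      open Unitary g using (isIsomorphism; isometric)
      open IsLeftModuleIsomorphism isIsomorphism

  unitaryGroup : Group (m ⊔ ℓ) (m ⊔ ℓ)
  unitaryGroup = record
    { Carrier = Unitary
    ; _≈_     = λ g h → ∀ x → g · x ≈ᴹ h · x
    ; _∙_     = compose
    ; ε       = identity
    ; _⁻¹     = inverse
    ; isGroup = record
      { isMonoid = record
        { isSemigroup = record
          { isMagma = record
            { isEquivalence = record
              { refl  = λ _ → ≈ᴹ-refl
              ; sym   = λ p x → ≈ᴹ-sym (p x)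
              ; trans = λ p q x → ≈ᴹ-trans (p x) (q x)
              }
            ; ∙-cong = λ {g} {g′} {h} {h′} p q x →
                ≈ᴹ-trans (·-cong g (q x)) (p (h′ · x))
            }
          ; assoc = λ _ _ _ _ → ≈ᴹ-refl
          }
        ; identity = (λ _ _ → ≈ᴹ-refl) , (λ _ _ → ≈ᴹ-refl)
        }
      ; inverse = (λ g x → Inverse.to⇒from g ≈ᴹ-refl) , (λ g → Inverse.to-from g)
      ; ⁻¹-cong = λ {g} {h} p x → Inverse.to⇒from g
          (≈ᴹ-trans (p (inverse h · x)) (Inverse.to-from h x))
      }
    }

  open Group unitaryGroup using (_≈_; _∙_; ε; _⁻¹)
  open Subgroups unitaryGroup public

  Orbit : ∀ {p} → Subgroup p → Vec → Pred Vec (m ⊔ ℓ ⊔ p)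
  Orbit G x₀ x = ∃[ g ] g ∈ member G × x ≈ᴹ g · x₀

  Stab : ∀ {p} → Subgroup p → Vec → Pred Unitary (ℓ ⊔ p)
  Stab H x₀ h = h ∈ member H × h · x₀ ≈ᴹ x₀

  HasFullOrbit : ∀ {p} → Subgroup p → Vec → Set (m ⊔ ℓ ⊔ p)
  HasFullOrbit G x₀ = ∃[ n ] HasCardinality (Group.setoid unitaryGroup) (member G) n ×
                             HasCardinality vectors (Orbit G x₀) n

  FR : ∀ {p} → Subgroup p → Vec → Pred Vec (m ⊔ ℓ ⊔ p)
  FR H x₀ x = ∀ h → h ∈ member H → h ∉ Stab H x₀ → ‖ x -ᵛ x₀ ‖ < ‖ h · x -ᵛ x₀ ‖

  -- x₀ ∈ c(FR(H))
  IsMinimal : ∀ {p} → Subgroup p → Vec → Unitary → Set (m ⊔ ℓ ⊔ p)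
  IsMinimal H x₀ c = ∃[ x ] x ∈ FR H x₀ × x₀ ≈ᴹ c · x

  -- The first element of the list at which f is smallest.
  argmin : ∀ {a} {A : Set a} → (A → R) → List⁺ A → A
  argmin {A = A} f = foldr₁ better
    where
    better : A → A → A
    better a b with f a ≤? f b
    ... | yes _ = a
    ... | no  _ = b

  module _ {p} {G : Subgroup p} {n : ℕ} (𝒮 : SubgroupSequence G n) (x₀ : Vec) where
    open SubgroupSequence 𝒮

    -- residual r k is r_k, and choice r k is d_{k+1}.
    residual : Vec → ℕ → Vec
    choice   : Vec → ℕ → Unitary

    residual r zero    = r
    residual r (suc k) = choice r k · residual r k

    choice r k = argmin (λ a → ‖ a · residual r k -ᵛ x₀ ‖) (leaders k)

    product : Vec → ℕ → Unitary
    product r zero    = ε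
    product r (suc k) = choice r k ∙ product r k

    decode : Vec → Unitary
    decode r = product r n

    DecodesWithSomeNoise : Set (m ⊔ ℓ ⊔ p)
    DecodesWithSomeNoise =
      ∃[ δ ] 0# < δ ×
             (∀ g → g ∈ member G → ∀ r → ‖ r -ᵛ (g ⁻¹) · x₀ ‖ < δ →
              decode r ∈ RightCoset (Stab G x₀) g)

    AllInducedLeadersMinimal : Set (m ⊔ ℓ ⊔ p)
    AllInducedLeadersMinimal =
      ∀ k → k <ℕ n → ∀ c → c ∈ InducedLeader k n → IsMinimal (𝐆 k) x₀ c

module Submission where

open import Defs
open import Algebra.Bundles using (CommutativeRing; Group)
import Algebra.Properties.AbelianGroup as AbelianGroupProperties
import Algebra.Properties.Group as GroupProperties
open import Algebra.Module.Morphism.Structures using (module LeftModuleMorphisms)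
import Algebra.Properties.Ring as RingProperties
import Algebra.Solver.Ring.NaturalCoefficients.Default as SemiringSolver
import Data.List.Extrema as Extrema
open import Data.Fin using (Fin; punchOut)
open import Data.Fin.Properties using (any?; injective⇒≤; punchOut-injective)
  renaming (_≟_ to _≟ꟳ_)
open import Data.List using (List; []; _∷_; allFin; cartesianProduct)
import Data.List as List
open import Data.List.Membership.Propositional using (find) renaming (_∈_ to _∈ˡ_)
open import Data.List.Membership.Propositional.Properties using (∈-allFin; ∈-cartesianProduct⁺)
open import Data.List.NonEmpty using (List⁺; toList) renaming (_∷_ to _∷⁺_)
open import Data.List.Relation.Unary.All as All using (All)
open import Data.List.Relation.Unary.All.Properties using () renaming (map⁻ to All-map⁻; map⁺ to All-map⁺)
open import Data.List.Relation.Unary.AllPairs using (AllPairs; _∷_)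
open import Data.List.Relation.Unary.Any as Any using (Any; here; there)
open import Data.Nat using (ℕ; zero; suc; _≤′_; ≤′-refl; ≤′-step) renaming (_≤_ to _≤ℕ_; _<_ to _<ℕ_)
import Data.Nat.Properties as ℕ
open import Data.Product using (∃-syntax; _×_; _,_; proj₁; proj₂)
open import Data.Sum using (_⊎_; inj₁; inj₂)
open import Function using (id)
open import Function.Bundles using (Bijection; _⇔_; mk⇔)
open import Function.Definitions using (Injective)
open import Level using (0ℓ; _⊔_)
open import Relation.Binary.Bundles using (DecTotalOrder)
import Relation.Binary.Properties.DecTotalOrder as DecTotalOrderProperties
import Relation.Binary.Reasoning.PartialOrder as PartialOrderReasoning
import Relation.Binary.Reasoning.Setoid as SetoidReasoning
open import Relation.Binary.PropositionalEquality as ≡ using (_≡_)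
open import Relation.Nullary using (¬_; yes; no; contradiction)
open import Relation.Unary using (_∈_; _⊆_)

-- A full orbit makes the stabilizer of x₀ trivial, and for unitary g the order of the distances
-- ‖g x - x₀‖ is opposite to that of Re⟨g x, x₀⟩; so c is minimal for H exactly when
-- Re⟨h c⁻¹x₀, x₀⟩ < Re⟨c⁻¹x₀, x₀⟩ for all h ≠ I in H.
--
-- If decoding tolerates noise, consider h ∈ 𝐆 k and an induced leader c of 𝐆 n / 𝐆 k.  Near
-- h c⁻¹x₀ the decoder outputs c h⁻¹, so by uniqueness of the factorization its first k steps
-- apply h⁻¹; as I is always a candidate these do not move r away from x₀, whence
-- Re⟨r, x₀⟩ ≤ Re⟨r, h x₀⟩ for all r near h c⁻¹x₀.  Perturbing r along x₀ - h x₀ makes this strict.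
--
-- Conversely let γ > 0 be at most every gap between distinct values Re⟨g x₀, x₀⟩, and
-- δ = γ / 2.  If g = c_n ⋯ c_1 and the decoder has chosen c_1, …, c_k, its residual is within δ of
-- (c_n ⋯ c_{k+1})⁻¹x₀, and minimality of c_n ⋯ c_{k+2} separates c_{k+1} from the other
-- candidates by at least γ, which the noise cannot overcome.

-- Arithmetic in an ordered field.

module OrderedField (ℝ : Reals) where
  open Reals ℝ public
  open CommutativeRing commutativeRing public
    hiding (Carrier; _≈_; _+_; _*_; -_; 0#; 1#; isCommutativeRing)
  open RingProperties ring public

  decTotalOrder : DecTotalOrder 0ℓ 0ℓ 0ℓ
  decTotalOrder = record { isDecTotalOrder = isDecTotalOrder }

  open DecTotalOrder decTotalOrder public
    using (_≟_; totalOrder; poset)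
    renaming (total to ≤-total; refl to ≤-refl; reflexive to ≤-reflexive; trans to ≤-trans)
  open DecTotalOrderProperties decTotalOrder public
    using (≰⇒>; <⇒≱; ≮⇒≥; ≤∧≉⇒<)
  module Reasoning = PartialOrderReasoning poset
  open Reasoning
  open SemiringSolver commutativeSemiring public using (solve; _:=_; _:+_; _:*_)

  +-cancelʳ-≤ : ∀ z {x y} → x + z ≤ y + z → x ≤ y
  +-cancelʳ-≤ z {x} {y} x+z≤y+z = begin
    x              ≈⟨ cancel x ⟨
    x + z + - z    ≤⟨ +-monoˡ-≤ (- z) x+z≤y+z ⟩
    y + z + - z    ≈⟨ cancel y ⟩
    y              ∎
    where
    cancel : ∀ w → w + z + - z ≈ w
    cancel w = trans (+-assoc w z (- z)) (trans (+-congˡ (-‿inverseʳ z)) (+-identityʳ w))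

  +-monoʳ-≤ : ∀ z {x y} → x ≤ y → z + x ≤ z + y
  +-monoʳ-≤ z {x} {y} x≤y = begin
    z + x  ≈⟨ +-comm z x ⟩
    x + z  ≤⟨ +-monoˡ-≤ z x≤y ⟩
    y + z  ≈⟨ +-comm y z ⟩
    z + y  ∎

  +-monoˡ-< : ∀ z {x y} → x < y → x + z < y + z
  +-monoˡ-< z x<y = ≰⇒> λ y+z≤x+z → <⇒≱ x<y (+-cancelʳ-≤ z y+z≤x+z)

  +-monoʳ-< : ∀ z {x y} → x < y → z + x < z + y
  +-monoʳ-< z {x} {y} x<y = begin-strict
    z + x  ≈⟨ +-comm z x ⟩
    x + z  <⟨ +-monoˡ-< z x<y ⟩
    y + z  ≈⟨ +-comm y z ⟩
    z + y  ∎

  +-cancelʳ-< : ∀ z {x y} → x + z < y + z → x < y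
  +-cancelʳ-< z x+z<y+z = ≰⇒> λ y≤x → <⇒≱ x+z<y+z (+-monoˡ-≤ z y≤x)

  double-cancel-≤ : ∀ {x y} → x + x ≤ y + y → x ≤ y
  double-cancel-≤ {x} {y} 2x≤2y = ≮⇒≥ λ y<x → <⇒≱ (begin-strict
    y + y  <⟨ +-monoˡ-< y y<x ⟩
    x + y  <⟨ +-monoʳ-< x y<x ⟩
    x + x  ∎) 2x≤2y

  double-cancel-< : ∀ {x y} → x + x < y + y → x < y
  double-cancel-< {x} {y} 2x<2y = ≰⇒> λ y≤x → <⇒≱ 2x<2y (begin
    y + y  ≤⟨ +-monoˡ-≤ y y≤x ⟩
    x + y  ≤⟨ +-monoʳ-≤ x y≤x ⟩
    x + x  ∎)

  x≤y⇒0≤y-x : ∀ {x y} → x ≤ y → 0# ≤ y + - x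
  x≤y⇒0≤y-x {x} {y} x≤y = begin
    0#       ≈⟨ -‿inverseʳ x ⟨
    x + - x  ≤⟨ +-monoˡ-≤ (- x) x≤y ⟩
    y + - x  ∎

  x<y⇒0<y-x : ∀ {x y} → x < y → 0# < y + - x
  x<y⇒0<y-x {x} {y} x<y = begin-strict
    0#       ≈⟨ -‿inverseʳ x ⟨
    x + - x  <⟨ +-monoˡ-< (- x) x<y ⟩
    y + - x  ∎

  y-x+x≈y : ∀ x y → y + - x + x ≈ y
  y-x+x≈y x y = trans (+-assoc y (- x) x) (trans (+-congˡ (-‿inverseˡ x)) (+-identityʳ y))

  *-monoˡ-≤ : ∀ {z x y} → 0# ≤ z → x ≤ y → z * x ≤ z * y
  *-monoˡ-≤ {z} {x} {y} 0≤z x≤y = begin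
    z * x                       ≈⟨ +-identityˡ _ ⟨
    0# + z * x                  ≤⟨ +-monoˡ-≤ (z * x) (*-nonneg 0≤z (x≤y⇒0≤y-x x≤y)) ⟩
    z * (y + - x) + z * x       ≈⟨ distribˡ z _ _ ⟨
    z * (y + - x + x)           ≈⟨ *-congˡ (y-x+x≈y x y) ⟩
    z * y                       ∎

  *-monoʳ-≤ : ∀ {z x y} → 0# ≤ z → x ≤ y → x * z ≤ y * z
  *-monoʳ-≤ {z} {x} {y} 0≤z x≤y = begin
    x * z  ≈⟨ *-comm x z ⟩
    z * x  ≤⟨ *-monoˡ-≤ 0≤z x≤y ⟩
    z * y  ≈⟨ *-comm z y ⟩
    y * z  ∎

  *-pos : ∀ {x y} → 0# < x → 0# < y → 0# < x * y
  *-pos {x} {y} (0≤x , 0≉x) (0≤y , 0≉y) = *-nonneg 0≤x 0≤y , λ 0≈xy → 0≉y (begin-equality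
    0#              ≈⟨ zeroʳ x⁻¹ ⟨
    x⁻¹ * 0#        ≈⟨ *-congˡ 0≈xy ⟩
    x⁻¹ * (x * y)   ≈⟨ *-assoc x⁻¹ x y ⟨
    x⁻¹ * x * y     ≈⟨ *-congʳ (trans (*-comm x⁻¹ x) (proj₂ inv)) ⟩
    1# * y          ≈⟨ *-identityˡ y ⟩
    y               ∎)
    where
    inv : ∃[ z ] x * z ≈ 1#
    inv = inverse x λ x≈0 → 0≉x (sym x≈0)
    x⁻¹ : Carrier
    x⁻¹ = proj₁ inv

  *-monoˡ-< : ∀ {z x y} → 0# < z → x < y → z * x < z * y
  *-monoˡ-< {z} {x} {y} 0<z x<y = begin-strict
    z * x                       ≈⟨ +-identityˡ _ ⟨
    0# + z * x                  <⟨ +-monoˡ-< (z * x) (*-pos 0<z (x<y⇒0<y-x x<y)) ⟩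
    z * (y + - x) + z * x       ≈⟨ distribˡ z _ _ ⟨
    z * (y + - x + x)           ≈⟨ *-congˡ (y-x+x≈y x y) ⟩
    z * y                       ∎

  *-cancelˡ-< : ∀ {z x y} → 0# ≤ z → z * x < z * y → x < y
  *-cancelˡ-< 0≤z zx<zy = ≰⇒> λ y≤x → <⇒≱ zx<zy (*-monoˡ-≤ 0≤z y≤x)

  square-mono-≤ : ∀ {x y} → 0# ≤ x → x ≤ y → x * x ≤ y * y
  square-mono-≤ {x} {y} 0≤x x≤y = begin
    x * x  ≤⟨ *-monoˡ-≤ 0≤x x≤y ⟩
    x * y  ≤⟨ *-monoʳ-≤ (≤-trans 0≤x x≤y) x≤y ⟩
    y * y  ∎

  square-mono-< : ∀ {x y} → 0# ≤ x → x < y → x * x < y * y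
  square-mono-< {x} {y} 0≤x x<y = begin-strict
    x * x  ≤⟨ *-monoˡ-≤ 0≤x (proj₁ x<y) ⟩
    x * y  ≈⟨ *-comm x y ⟩
    y * x  <⟨ *-monoˡ-< 0<y x<y ⟩
    y * y  ∎
    where
    0<y : 0# < y
    0<y = begin-strict 0# ≤⟨ 0≤x ⟩ x <⟨ x<y ⟩ y ∎

  square-cancel-≤ : ∀ {x y} → 0# ≤ y → x * x ≤ y * y → x ≤ y
  square-cancel-≤ 0≤y x²≤y² = ≮⇒≥ λ y<x → <⇒≱ (square-mono-< 0≤y y<x) x²≤y²

  -- If `1#` were at most `0#`, then `- 1#` would be nonnegative, and so would its square, which is
  -- `1#`.
  0<1 : 0# < 1#
  0<1 with ≤-total 0# 1#
  ... | inj₁ 0≤1 = 0≤1 , 0≉1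
  ... | inj₂ 1≤0 = contradiction 1≤0 (<⇒≱ (≤∧≉⇒< 0≤1 0≉1))
    where
    0≤-1 : 0# ≤ - 1#
    0≤-1 = begin
      0#         ≤⟨ x≤y⇒0≤y-x 1≤0 ⟩
      0# + - 1#  ≈⟨ +-identityˡ _ ⟩
      - 1#       ∎
    0≤1 : 0# ≤ 1#
    0≤1 = begin
      0#           ≤⟨ *-nonneg 0≤-1 0≤-1 ⟩
      - 1# * - 1#  ≈⟨ -1*x≈-x (- 1#) ⟩
      - - 1#       ≈⟨ -‿involutive 1# ⟩
      1#           ∎

  -- Applied to two instances of `polarization` with equal right sides, this exchanges a comparison
  -- of squared distances for the reverse comparison of inner products.
  swap-≤ : ∀ {a b p q} → a + p ≈ b + q → a ≤ b → q ≤ p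
  swap-≤ {a} {b} {p} {q} a+p≈b+q a≤b = +-cancelʳ-≤ a (begin
    q + a  ≤⟨ +-monoʳ-≤ q a≤b ⟩
    q + b  ≈⟨ +-comm q b ⟩
    b + q  ≈⟨ a+p≈b+q ⟨
    a + p  ≈⟨ +-comm a p ⟩
    p + a  ∎)

  -- The order makes 2 nonzero, hence invertible. This supplies the noise radius: half of the least
  -- score gap.
  midpoint : ∀ {x} → 0# < x → ∃[ y ] 0# < y × y + y ≈ x
  midpoint {x} 0<x = y , double-cancel-< 0+0<y+y , y+y≈x
    where
    0<2 : 0# < 1# + 1#
    0<2 = begin-strict
      0#       <⟨ 0<1 ⟩
      1#       ≈⟨ +-identityˡ 1# ⟨
      0# + 1#  ≤⟨ +-monoˡ-≤ 1# (proj₁ 0<1) ⟩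
      1# + 1#  ∎
    2⁻¹ : ∃[ h ] (1# + 1#) * h ≈ 1#
    2⁻¹ = inverse (1# + 1#) λ 2≈0 → proj₂ 0<2 (sym 2≈0)
    y : Carrier
    y = proj₁ 2⁻¹ * x
    y+y≈x : y + y ≈ x
    y+y≈x = begin-equality
      y + y                         ≈⟨ +-cong (*-identityˡ y) (*-identityˡ y) ⟨
      1# * y + 1# * y               ≈⟨ distribʳ y 1# 1# ⟨
      (1# + 1#) * (proj₁ 2⁻¹ * x)   ≈⟨ *-assoc _ _ _ ⟨
      (1# + 1#) * proj₁ 2⁻¹ * x     ≈⟨ *-congʳ (proj₂ 2⁻¹) ⟩
      1# * x                        ≈⟨ *-identityˡ x ⟩
      x                             ∎
    0+0<y+y : 0# + 0# < y + y
    0+0<y+y = begin-strict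
      0# + 0#  ≈⟨ +-identityˡ 0# ⟩
      0#       <⟨ 0<x ⟩
      x        ≈⟨ y+y≈x ⟨
      y + y    ∎

  positive-gap : ∀ {n} (F : Fin n → Carrier) →
                 ∃[ γ ] 0# < γ × (∀ i j → F i < F j → F i + γ ≤ F j)
  positive-gap {n} F = γ , 0<γ , γ-bound
    where
    open Extrema totalOrder using (min; v<f[argmin]⁺; f[argmin]≤f[xs])
    gap : Fin n × Fin n → Carrier
    gap (i , j) with F j ≤? F i
    -- A pair that is not increasing contributes the positive filler `1#`. The minimum `γ` also
    -- starts from `1#`, so it is positive even for an empty family.
    ... | yes _ = 1#
    ... | no  _ = F j + - F i
    0<gap : ∀ ij → 0# < gap ij
    0<gap (i , j) with F j ≤? F i
    ... | yes _     = 0<1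
    ... | no  Fj≰Fi = x<y⇒0<y-x (≰⇒> Fj≰Fi)
    gap-bound : ∀ i j → F i < F j → F i + gap (i , j) ≤ F j
    gap-bound i j Fi<Fj with F j ≤? F i
    ... | yes Fj≤Fi = contradiction Fj≤Fi (<⇒≱ Fi<Fj)
    ... | no  _     = ≤-reflexive (trans (+-comm _ _) (y-x+x≈y (F i) (F j)))
    gaps : List Carrier
    gaps = List.map gap (cartesianProduct (allFin n) (allFin n))
    γ : Carrier
    γ = min 1# gaps
    0<γ : 0# < γ
    0<γ = v<f[argmin]⁺ {f = id} {xs = gaps} 0<1
            (All-map⁺ (All.universal 0<gap (cartesianProduct (allFin n) (allFin n))))
    γ-bound : ∀ i j → F i < F j → F i + γ ≤ F j
    γ-bound i j Fi<Fj = begin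
      F i + γ             ≤⟨ +-monoʳ-≤ (F i) (All.lookup (All-map⁻ (f[argmin]≤f[xs] {f = id} 1# gaps))
                               (∈-cartesianProduct⁺ (∈-allFin i) (∈-allFin j))) ⟩
      F i + gap (i , j)   ≤⟨ gap-bound i j Fi<Fj ⟩
      F j                 ∎

-- Real inner products and distances in a Hermitian space.

module InnerProduct {ℝ : Reals} {m ℓ} (V : HermitianSpace ℝ m ℓ) where
  open OrderedField ℝ
  open Reasoning
  open Complex ℝ using (re)
  open HermitianSpace V
  module Additive = AbelianGroupProperties +ᴹ-abelianGroup

  -- The Euclidean inner product of the underlying real space: it is symmetric and already
  -- determines the norm.
  _∙ᵛ_ : Vec → Vec → Carrier
  x ∙ᵛ y = re ⟨ x , y ⟩

  infix 7.5 _∙ᵛ_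

  ∙ᵛ-cong : ∀ {x x′ y y′} → x ≈ᴹ x′ → y ≈ᴹ y′ → x ∙ᵛ y ≈ x′ ∙ᵛ y′
  ∙ᵛ-cong p q = proj₁ (⟨,⟩-cong p q)

  ∙ᵛ-comm : ∀ x y → x ∙ᵛ y ≈ y ∙ᵛ x
  ∙ᵛ-comm x y = proj₁ (⟨,⟩-conj x y)

  ∙ᵛ-+ˡ : ∀ x y z → (x +ᴹ y) ∙ᵛ z ≈ x ∙ᵛ z + y ∙ᵛ z
  ∙ᵛ-+ˡ x y z = proj₁ (⟨,⟩-+ˡ x y z)

  ∙ᵛ-+ʳ : ∀ x y z → x ∙ᵛ (y +ᴹ z) ≈ x ∙ᵛ y + x ∙ᵛ z
  ∙ᵛ-+ʳ x y z = begin-equality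
    x ∙ᵛ (y +ᴹ z)      ≈⟨ ∙ᵛ-comm x _ ⟩
    (y +ᴹ z) ∙ᵛ x      ≈⟨ ∙ᵛ-+ˡ y z x ⟩
    y ∙ᵛ x + z ∙ᵛ x    ≈⟨ +-cong (∙ᵛ-comm y x) (∙ᵛ-comm z x) ⟩
    x ∙ᵛ y + x ∙ᵛ z    ∎

  infixr 7 _⋆_
  _⋆_ : Carrier → Vec → Vec
  t ⋆ x = (t , 0#) *ₗ x

  ∙ᵛ-⋆ˡ : ∀ t x y → (t ⋆ x) ∙ᵛ y ≈ t * x ∙ᵛ y
  ∙ᵛ-⋆ˡ t x y = begin-equality
    (t ⋆ x) ∙ᵛ y              ≈⟨ proj₁ (⟨,⟩-*ˡ (t , 0#) x y) ⟩
    t * x ∙ᵛ y + - (0# * _)   ≈⟨ +-congˡ (trans (-‿cong (zeroˡ _)) -0#≈0#) ⟩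
    t * x ∙ᵛ y + 0#           ≈⟨ +-identityʳ _ ⟩
    t * x ∙ᵛ y                ∎

  ∙ᵛ-⋆ʳ : ∀ t x y → x ∙ᵛ (t ⋆ y) ≈ t * x ∙ᵛ y
  ∙ᵛ-⋆ʳ t x y = trans (∙ᵛ-comm x _) (trans (∙ᵛ-⋆ˡ t y x) (*-congˡ (∙ᵛ-comm y x)))

  ∙ᵛ-0ˡ : ∀ x → 0ᴹ ∙ᵛ x ≈ 0#
  ∙ᵛ-0ˡ x = x+x≈x⇒x≈0 _ (trans (sym (∙ᵛ-+ˡ 0ᴹ 0ᴹ x)) (∙ᵛ-cong (+ᴹ-identityˡ 0ᴹ) ≈ᴹ-refl))

  y-x+x≈ᴹy : ∀ x y → y -ᵛ x +ᴹ x ≈ᴹ y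
  y-x+x≈ᴹy x y = ≈ᴹ-trans (+ᴹ-assoc y (-ᴹ x) x) (≈ᴹ-trans (+ᴹ-congˡ (-ᴹ‿inverseˡ x)) (+ᴹ-identityʳ y))

  ∙ᵛ-minusˡ : ∀ x y z → (x -ᵛ y) ∙ᵛ z + y ∙ᵛ z ≈ x ∙ᵛ z
  ∙ᵛ-minusˡ x y z = trans (sym (∙ᵛ-+ˡ (x -ᵛ y) y z)) (∙ᵛ-cong (y-x+x≈ᴹy y x) ≈ᴹ-refl)

  -- ‖x - y‖² = ‖x‖² + ‖y‖² - 2 Re⟨x,y⟩ with the subtracted term moved to the left.
  polarization : ∀ x y → (x -ᵛ y) ∙ᵛ (x -ᵛ y) + (x ∙ᵛ y + x ∙ᵛ y) ≈ x ∙ᵛ x + y ∙ᵛ y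
  polarization x y = begin-equality
    d ∙ᵛ d + (x ∙ᵛ y + x ∙ᵛ y)
      ≈⟨ +-congˡ (+-cong (∙ᵛ-minusˡ x y y) (∙ᵛ-minusˡ x y y)) ⟨
    d ∙ᵛ d + ((d ∙ᵛ y + y ∙ᵛ y) + (d ∙ᵛ y + y ∙ᵛ y))
      ≈⟨ solve 3 (λ a b c → a :+ ((b :+ c) :+ (b :+ c)) := ((a :+ b) :+ (b :+ c)) :+ c) refl _ _ _ ⟩
    ((d ∙ᵛ d + d ∙ᵛ y) + (d ∙ᵛ y + y ∙ᵛ y)) + y ∙ᵛ y
      ≈⟨ +-congʳ (+-cong (∙ᵛ-+ʳ d d y) (trans (∙ᵛ-+ʳ y d y) (+-congʳ (∙ᵛ-comm y d)))) ⟨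
    (d ∙ᵛ (d +ᴹ y) + y ∙ᵛ (d +ᴹ y)) + y ∙ᵛ y
      ≈⟨ +-congʳ (∙ᵛ-+ˡ d y (d +ᴹ y)) ⟨
    (d +ᴹ y) ∙ᵛ (d +ᴹ y) + y ∙ᵛ y
      ≈⟨ +-congʳ (∙ᵛ-cong (y-x+x≈ᴹy y x) (y-x+x≈ᴹy y x)) ⟩
    x ∙ᵛ x + y ∙ᵛ y  ∎
    where
    d : Vec
    d = x -ᵛ y

  x-y≈0⇒x≈y : ∀ {x y} → x -ᵛ y ≈ᴹ 0ᴹ → x ≈ᴹ y
  x-y≈0⇒x≈y = Additive.x∙y⁻¹≈ε⇒x≈y _ _

  0<∙ᵛ : ∀ {x y} → ¬ (x ≈ᴹ y) → 0# < (x -ᵛ y) ∙ᵛ (x -ᵛ y)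
  0<∙ᵛ x≉y = ⟨,⟩-nonneg _ , λ 0≈d∙d → x≉y (x-y≈0⇒x≈y (⟨,⟩-definite _ (sym 0≈d∙d)))

  -- The strict case of Cauchy-Schwarz for vectors of equal norm: in `polarization` the square of
  -- `x -ᵛ y` is positive.
  unequal-∙ᵛ : ∀ {x y} → x ∙ᵛ x ≈ y ∙ᵛ y → ¬ (x ≈ᴹ y) → x ∙ᵛ y < y ∙ᵛ y
  unequal-∙ᵛ {x} {y} x²≈y² x≉y = double-cancel-< (begin-strict
    x ∙ᵛ y + x ∙ᵛ y                           ≈⟨ +-identityˡ _ ⟨
    0# + (x ∙ᵛ y + x ∙ᵛ y)                    <⟨ +-monoˡ-< _ (0<∙ᵛ x≉y) ⟩
    (x -ᵛ y) ∙ᵛ (x -ᵛ y) + (x ∙ᵛ y + x ∙ᵛ y)  ≈⟨ polarization x y ⟩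
    x ∙ᵛ x + y ∙ᵛ y                           ≈⟨ +-congʳ x²≈y² ⟩
    y ∙ᵛ y + y ∙ᵛ y                           ∎)

  -- Equality of vectors is not assumed decidable, but it amounts to the vanishing of the real
  -- number `(x -ᵛ y) ∙ᵛ (x -ᵛ y)`, which is.
  ≈ᴹ-stable : ∀ {x y} → ¬ ¬ (x ≈ᴹ y) → x ≈ᴹ y
  ≈ᴹ-stable {x} {y} ¬x≉y with (x -ᵛ y) ∙ᵛ (x -ᵛ y) ≟ 0#
  ... | yes d∙d≈0 = x-y≈0⇒x≈y (⟨,⟩-definite _ d∙d≈0)
  ... | no  d∙d≉0 = contradiction (λ x≈y → d∙d≉0 (trans
                      (∙ᵛ-cong (Additive.x≈y⇒x∙y⁻¹≈ε x≈y) ≈ᴹ-refl) (∙ᵛ-0ˡ _))) ¬x≉y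

  ‖‖-mono-≤ : ∀ {x y} → x ∙ᵛ x ≤ y ∙ᵛ y → ‖ x ‖ ≤ ‖ y ‖
  ‖‖-mono-≤ {x} {y} x²≤y² = square-cancel-≤ (‖‖-nonneg y) (begin
    ‖ x ‖ * ‖ x ‖  ≈⟨ ‖‖-square x ⟩
    x ∙ᵛ x         ≤⟨ x²≤y² ⟩
    y ∙ᵛ y         ≈⟨ ‖‖-square y ⟨
    ‖ y ‖ * ‖ y ‖  ∎)

  ‖‖-cancel-≤ : ∀ {x y} → ‖ x ‖ ≤ ‖ y ‖ → x ∙ᵛ x ≤ y ∙ᵛ y
  ‖‖-cancel-≤ {x} {y} ‖x‖≤‖y‖ = begin
    x ∙ᵛ x         ≈⟨ ‖‖-square x ⟨
    ‖ x ‖ * ‖ x ‖  ≤⟨ square-mono-≤ (‖‖-nonneg x) ‖x‖≤‖y‖ ⟩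
    ‖ y ‖ * ‖ y ‖  ≈⟨ ‖‖-square y ⟩
    y ∙ᵛ y         ∎

  -- The norm is not assumed to respect `_≈ᴹ_`; its square does, and nonnegativity carries this back
  -- to the norm.
  ‖‖-cong : ∀ {x y} → x ≈ᴹ y → ‖ x ‖ ≤ ‖ y ‖
  ‖‖-cong x≈y = ‖‖-mono-≤ (≤-reflexive (∙ᵛ-cong x≈y x≈y))

  distance-congˡ : ∀ {x x′ y} → x ≈ᴹ x′ → ‖ x -ᵛ y ‖ ≤ ‖ x′ -ᵛ y ‖
  distance-congˡ x≈x′ = ‖‖-cong (+ᴹ-congʳ x≈x′)

  module _ {x y z : Vec} (x²≈y² : x ∙ᵛ x ≈ y ∙ᵛ y) where
    private
      balance : (x -ᵛ z) ∙ᵛ (x -ᵛ z) + (x ∙ᵛ z + x ∙ᵛ z) ≈ (y -ᵛ z) ∙ᵛ (y -ᵛ z) + (y ∙ᵛ z + y ∙ᵛ z)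
      balance = trans (polarization x z) (trans (+-congʳ x²≈y²) (sym (polarization y z)))

    -- For `x` and `y` of equal norm, `balance` says that squared distance to `z` plus twice the
    -- inner product with `z` is the same for both.
    closer⇒∙ᵛ : ‖ x -ᵛ z ‖ ≤ ‖ y -ᵛ z ‖ → y ∙ᵛ z ≤ x ∙ᵛ z
    closer⇒∙ᵛ d≤d = double-cancel-≤ (swap-≤ balance (‖‖-cancel-≤ d≤d))

    ∙ᵛ⇒closer : y ∙ᵛ z ≤ x ∙ᵛ z → ‖ x -ᵛ z ‖ ≤ ‖ y -ᵛ z ‖
    ∙ᵛ⇒closer yz≤xz = ‖‖-mono-≤ (swap-≤
      (trans (+-comm _ _) (trans (sym balance) (+-comm _ _)))
      (≤-trans (+-monoˡ-≤ _ yz≤xz) (+-monoʳ-≤ _ yz≤xz)))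

  closer⇒∙ᵛ-< : ∀ {x y z} → x ∙ᵛ x ≈ y ∙ᵛ y → ‖ x -ᵛ z ‖ < ‖ y -ᵛ z ‖ → y ∙ᵛ z < x ∙ᵛ z
  closer⇒∙ᵛ-< x²≈y² d<d = ≰⇒> λ xz≤yz → <⇒≱ d<d (∙ᵛ⇒closer (sym x²≈y²) xz≤yz)

  ∙ᵛ⇒closer-< : ∀ {x y z} → x ∙ᵛ x ≈ y ∙ᵛ y → y ∙ᵛ z < x ∙ᵛ z → ‖ x -ᵛ z ‖ < ‖ y -ᵛ z ‖
  ∙ᵛ⇒closer-< x²≈y² yz<xz = ≰⇒> λ d≤d → <⇒≱ yz<xz (closer⇒∙ᵛ (sym x²≈y²) d≤d)

  -- Cauchy-Schwarz against a unit vector, read off from the nonnegative square of `v -ᵛ δ ⋆ e`: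
  -- twice `δ * v ∙ᵛ e` is at most `‖ v ‖ * ‖ v ‖ + δ * δ`, which is below twice `δ * δ`.
  ∙ᵛ-unit-< : ∀ {v e δ} → e ∙ᵛ e ≈ 1# → ‖ v ‖ < δ → v ∙ᵛ e < δ
  ∙ᵛ-unit-< {v} {e} {δ} e²≈1 ‖v‖<δ = *-cancelˡ-< 0≤δ (double-cancel-< (begin-strict
    δ * v ∙ᵛ e + δ * v ∙ᵛ e            ≈⟨ +-cong (∙ᵛ-⋆ʳ δ v e) (∙ᵛ-⋆ʳ δ v e) ⟨
    v ∙ᵛ w + v ∙ᵛ w                    ≈⟨ +-identityˡ _ ⟨
    0# + (v ∙ᵛ w + v ∙ᵛ w)             ≤⟨ +-monoˡ-≤ _ (⟨,⟩-nonneg (v -ᵛ w)) ⟩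
    (v -ᵛ w) ∙ᵛ (v -ᵛ w) + (v ∙ᵛ w + v ∙ᵛ w)  ≈⟨ polarization v w ⟩
    v ∙ᵛ v + w ∙ᵛ w                    ≈⟨ +-cong (sym (‖‖-square v)) w²≈δ² ⟩
    ‖ v ‖ * ‖ v ‖ + δ * δ              <⟨ +-monoˡ-< _ (square-mono-< (‖‖-nonneg v) ‖v‖<δ) ⟩
    δ * δ + δ * δ                      ∎))
    where
    w : Vec
    w = δ ⋆ e
    0≤δ : 0# ≤ δ
    0≤δ = ≤-trans (‖‖-nonneg v) (proj₁ ‖v‖<δ)
    w²≈δ² : w ∙ᵛ w ≈ δ * δ
    w²≈δ² = begin-equality
      w ∙ᵛ w              ≈⟨ ∙ᵛ-⋆ˡ δ e w ⟩
      δ * e ∙ᵛ w          ≈⟨ *-congˡ (∙ᵛ-⋆ʳ δ e e) ⟩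
      δ * (δ * e ∙ᵛ e)    ≈⟨ *-congˡ (trans (*-congˡ e²≈1) (*-identityʳ δ)) ⟩
      δ * δ               ∎

  -- The noise estimate: with `e` equal to `x₀` it bounds how far noise can shift the inner product
  -- on which the decoder's comparison rests.
  near⇒∙ᵛ-< : ∀ {x y e δ} → e ∙ᵛ e ≈ 1# → ‖ x -ᵛ y ‖ < δ → x ∙ᵛ e < y ∙ᵛ e + δ
  near⇒∙ᵛ-< {x} {y} {e} {δ} e²≈1 d<δ = begin-strict
    x ∙ᵛ e                     ≈⟨ ∙ᵛ-minusˡ x y e ⟨
    (x -ᵛ y) ∙ᵛ e + y ∙ᵛ e     <⟨ +-monoˡ-< _ (∙ᵛ-unit-< e²≈1 d<δ) ⟩
    δ + y ∙ᵛ e                 ≈⟨ +-comm _ _ ⟩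
    y ∙ᵛ e + δ                 ∎

  ‖x-y‖≤‖y-x‖ : ∀ x y → ‖ x -ᵛ y ‖ ≤ ‖ y -ᵛ x ‖
  ‖x-y‖≤‖y-x‖ x y = ‖‖-mono-≤ (≤-reflexive (+-cancelʳ _ _ _ (begin-equality
    (x -ᵛ y) ∙ᵛ (x -ᵛ y) + (x ∙ᵛ y + x ∙ᵛ y)  ≈⟨ polarization x y ⟩
    x ∙ᵛ x + y ∙ᵛ y                          ≈⟨ +-comm _ _ ⟩
    y ∙ᵛ y + x ∙ᵛ x                          ≈⟨ polarization y x ⟨
    (y -ᵛ x) ∙ᵛ (y -ᵛ x) + (y ∙ᵛ x + y ∙ᵛ x)  ≈⟨ +-congˡ (+-cong (∙ᵛ-comm y x) (∙ᵛ-comm y x)) ⟩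
    (y -ᵛ x) ∙ᵛ (y -ᵛ x) + (x ∙ᵛ y + x ∙ᵛ y)  ∎)))

  small-multiple : ∀ u {δ} → 0# < δ → ∃[ t ] 0# < t × ‖ t ⋆ u ‖ < δ
  small-multiple u {δ} 0<δ = t , 0<t , (begin-strict
    ‖ t ⋆ u ‖       ≤⟨ square-cancel-≤ (*-nonneg (proj₁ 0<t) (‖‖-nonneg u)) (≤-reflexive ‖tu‖²≈[t‖u‖]²) ⟩
    t * ‖ u ‖       <⟨ *-monoˡ-< 0<t u<s ⟩
    t * s           ≈⟨ ts≈δ ⟩
    δ               ∎)
    where
    s : Carrier
    -- The added `1#` makes `s` invertible even when `u` is zero and makes `t * ‖ u ‖` strictly
    -- smaller than `t * s`, which is `δ`.
    s = 1# + ‖ u ‖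
    u<s : ‖ u ‖ < s
    u<s = begin-strict
      ‖ u ‖         ≈⟨ +-identityˡ _ ⟨
      0# + ‖ u ‖    <⟨ +-monoˡ-< _ 0<1 ⟩
      1# + ‖ u ‖    ∎
    0<s : 0# < s
    0<s = begin-strict 0# ≤⟨ ‖‖-nonneg u ⟩ ‖ u ‖ <⟨ u<s ⟩ s ∎
    s⁻¹ : ∃[ r ] s * r ≈ 1#
    s⁻¹ = inverse s λ s≈0 → proj₂ 0<s (sym s≈0)
    t : Carrier
    t = δ * proj₁ s⁻¹
    ts≈δ : t * s ≈ δ
    ts≈δ = trans (*-assoc _ _ _) (trans (*-congˡ (trans (*-comm _ s) (proj₂ s⁻¹))) (*-identityʳ δ))
    0<t : 0# < t
    0<t = *-cancelˡ-< (proj₁ 0<s) (begin-strict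
      s * 0#  ≈⟨ zeroʳ s ⟩
      0#      <⟨ 0<δ ⟩
      δ       ≈⟨ ts≈δ ⟨
      t * s   ≈⟨ *-comm t s ⟩
      s * t   ∎)
    ‖tu‖²≈[t‖u‖]² : ‖ t ⋆ u ‖ * ‖ t ⋆ u ‖ ≈ (t * ‖ u ‖) * (t * ‖ u ‖)
    ‖tu‖²≈[t‖u‖]² = begin-equality
      ‖ t ⋆ u ‖ * ‖ t ⋆ u ‖      ≈⟨ ‖‖-square _ ⟩
      (t ⋆ u) ∙ᵛ (t ⋆ u)         ≈⟨ ∙ᵛ-⋆ˡ t u _ ⟩
      t * u ∙ᵛ (t ⋆ u)           ≈⟨ *-congˡ (∙ᵛ-⋆ʳ t u u) ⟩
      t * (t * u ∙ᵛ u)           ≈⟨ *-congˡ (*-congˡ (‖‖-square u)) ⟨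
      t * (t * (‖ u ‖ * ‖ u ‖))  ≈⟨ solve 2 (λ t n → t :* (t :* (n :* n)) := (t :* n) :* (t :* n)) refl _ _ ⟩
      (t * ‖ u ‖) * (t * ‖ u ‖)  ∎

  -- A tie at p would be broken in favour of y by moving p slightly in the direction y - z.
  locally-≤⇒< : ∀ {p y z δ} → ¬ (y ≈ᴹ z) → 0# < δ →
                (∀ r → ‖ r -ᵛ p ‖ < δ → r ∙ᵛ y ≤ r ∙ᵛ z) → p ∙ᵛ y < p ∙ᵛ z
  locally-≤⇒< {p} {y} {z} {δ} y≉z 0<δ locally-≤ = begin-strict
    p ∙ᵛ y                    ≈⟨ +-identityˡ _ ⟨
    0# + p ∙ᵛ y               <⟨ +-monoˡ-< _ (*-pos (proj₁ (proj₂ tiny)) (0<∙ᵛ y≉z)) ⟩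
    t * u ∙ᵛ u + p ∙ᵛ y       ≤⟨ +-cancelʳ-≤ (t * u ∙ᵛ z) shifted ⟩
    p ∙ᵛ z                    ∎
    where
    u : Vec
    u = y -ᵛ z
    tiny : ∃[ t ] 0# < t × ‖ t ⋆ u ‖ < δ
    tiny = small-multiple u 0<δ
    t : Carrier
    t = proj₁ tiny
    r : Vec
    r = p +ᴹ t ⋆ u
    r∙ : ∀ w → r ∙ᵛ w ≈ p ∙ᵛ w + t * u ∙ᵛ w
    r∙ w = trans (∙ᵛ-+ˡ p (t ⋆ u) w) (+-congˡ (∙ᵛ-⋆ˡ t u w))
    r-near-p : ‖ r -ᵛ p ‖ < δ
    r-near-p = begin-strict
      ‖ r -ᵛ p ‖    ≤⟨ ‖‖-cong (Additive.xyx⁻¹≈y p (t ⋆ u)) ⟩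
      ‖ t ⋆ u ‖     <⟨ proj₂ (proj₂ tiny) ⟩
      δ             ∎
    shifted : t * u ∙ᵛ u + p ∙ᵛ y + t * u ∙ᵛ z ≤ p ∙ᵛ z + t * u ∙ᵛ z
    shifted = begin
      t * u ∙ᵛ u + p ∙ᵛ y + t * u ∙ᵛ z
        ≈⟨ solve 4 (λ t a b c → t :* a :+ b :+ t :* c := b :+ t :* (a :+ c)) refl _ _ _ _ ⟩
      p ∙ᵛ y + t * (u ∙ᵛ u + u ∙ᵛ z)
        ≈⟨ +-congˡ (*-congˡ (trans (+-congˡ (∙ᵛ-comm u z)) u∙u+z∙u≈u∙y)) ⟩
      p ∙ᵛ y + t * u ∙ᵛ y      ≈⟨ r∙ y ⟨
      r ∙ᵛ y                   ≤⟨ locally-≤ r r-near-p ⟩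
      r ∙ᵛ z                   ≈⟨ r∙ z ⟩
      p ∙ᵛ z + t * u ∙ᵛ z      ∎
      where
      u∙u+z∙u≈u∙y : u ∙ᵛ u + z ∙ᵛ u ≈ u ∙ᵛ y
      u∙u+z∙u≈u∙y = trans (∙ᵛ-minusˡ y z u) (∙ᵛ-comm y u)

-- Pigeonhole principle and pairwise related lists.

-- Punching a missed value out of the codomain would inject `Fin (suc n)` into `Fin n`.
injective⇒hit : ∀ {n} {f : Fin n → Fin n} → Injective _≡_ _≡_ f → ∀ i → ∃[ j ] f j ≡ i
injective⇒hit {suc n} {f} f-inj i with any? (λ j → f j ≟ꟳ i)
... | yes hit  = hit
... | no  miss = contradiction (injective⇒≤ avoid-injective) ℕ.1+n≰n
  where
  i≢f : ∀ j → ¬ (i ≡ f j)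
  i≢f j i≡fj = miss (j , ≡.sym i≡fj)
  avoid-injective : Injective _≡_ _≡_ (λ j → punchOut (i≢f j))
  avoid-injective eq = f-inj (punchOut-injective (i≢f _) (i≢f _) eq)

-- `AllPairs` relates earlier entries to later ones only, so two members found independently may be
-- related in either order.
AllPairs-lookup : ∀ {a r} {A : Set a} {R : A → A → Set r} {xs x y} → AllPairs R xs →
                  x ∈ˡ xs → y ∈ˡ xs → x ≡ y ⊎ R x y ⊎ R y x
AllPairs-lookup (_ ∷ _)   (here ≡.refl) (here ≡.refl) = inj₁ ≡.refl
AllPairs-lookup (rs ∷ _)  (here ≡.refl) (there y∈)    = inj₂ (inj₁ (All.lookup rs y∈))
AllPairs-lookup (rs ∷ _)  (there x∈)    (here ≡.refl) = inj₂ (inj₂ (All.lookup rs x∈))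
AllPairs-lookup (_ ∷ rss) (there x∈)    (there y∈)    = AllPairs-lookup rss x∈ y∈

-- Coset leaders and unique factorization along the subgroup sequence.

module CosetLeaders {c ℓ} (𝒢 : Group c ℓ) where
  open Group 𝒢
  open GroupProperties 𝒢
  open Subgroups 𝒢
  open Subgroup using (resp-≈; ∙-closed; ⁻¹-closed)
  open SetoidReasoning setoid

  ax≈by⇒b∈aH : ∀ {p} (H : Subgroup p) {a b x y} → x ∈ member H → y ∈ member H →
               a ∙ x ≈ b ∙ y → b ∈ LeftCoset a (member H)
  ax≈by⇒b∈aH H {a} {b} {x} {y} x∈H y∈H ax≈by = x ∙ y ⁻¹ , ∙-closed H x∈H (⁻¹-closed H y∈H) , (begin
    b              ≈⟨ //-rightDividesʳ y b ⟨
    b ∙ y ∙ y ⁻¹   ≈⟨ ∙-congʳ ax≈by ⟨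
    a ∙ x ∙ y ⁻¹   ≈⟨ assoc a x (y ⁻¹) ⟩
    a ∙ (x ∙ y ⁻¹) ∎)

  -- The equation puts each of `a` and `b` in the coset of the other, which `distinct` forbids for
  -- entries at different positions, whichever comes first.
  leader-unique : ∀ {p} {K H : Subgroup p} {as} → IsCosetLeaders K H as → ∀ {a b x y} →
                  a ∈ˡ toList as → b ∈ˡ toList as → x ∈ member H → y ∈ member H →
                  a ∙ x ≈ b ∙ y → a ≈ b
  leader-unique {H = H} isLeaders a∈ b∈ x∈H y∈H ax≈by
    with AllPairs-lookup (IsCosetLeaders.distinct isLeaders) a∈ b∈
  ... | inj₁ ≡.refl      = refl
  ... | inj₂ (inj₁ b∉aH) = contradiction (ax≈by⇒b∈aH H x∈H y∈H ax≈by) b∉aH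
  ... | inj₂ (inj₂ a∉bH) = contradiction (ax≈by⇒b∈aH H y∈H x∈H (sym ax≈by)) a∉bH

  module _ {p} {G : Subgroup p} {n : ℕ} (𝒮 : SubgroupSequence G n) where
    open SubgroupSequence 𝒮
    open IsCosetLeaders using (in-K; complete)

    𝐆-mono : ∀ {k l} → k ≤′ l → l ≤ℕ n → member (𝐆 k) ⊆ member (𝐆 l)
    𝐆-mono ≤′-refl             l≤n g∈ = g∈
    𝐆-mono {l = suc l} (≤′-step k≤l) l<n g∈ = proj₁ (strict l l<n) (𝐆-mono k≤l (ℕ.<⇒≤ l<n) g∈)

    𝐆⊆G : ∀ {k} → k ≤ℕ n → member (𝐆 k) ⊆ member G
    𝐆⊆G k≤n g∈ = proj₁ top (𝐆-mono (ℕ.≤⇒≤′ k≤n) ℕ.≤-refl g∈)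

    leader∈𝐆 : ∀ {k} → k <ℕ n → ∀ {a} → a ∈ˡ toList (leaders k) → a ∈ member (𝐆 (suc k))
    leader∈𝐆 {k} k<n a∈ = All.lookup (in-K (isLeaders k k<n)) a∈

    induced⇒< : ∀ {k l c} → c ∈ InducedLeader k l → k <ℕ l
    induced⇒< (first _)  = ℕ.≤-refl
    induced⇒< (next _ c) = ℕ.m≤n⇒m≤1+n (induced⇒< c)

    induced∈𝐆 : ∀ {k l c} → c ∈ InducedLeader k l → l ≤ℕ n → c ∈ member (𝐆 l)
    induced∈𝐆 {l = suc l} (first a∈) l<n with find a∈
    ... | b , b∈ , a≈b = resp-≈ (𝐆 (suc l)) (sym a≈b) (leader∈𝐆 l<n b∈)
    induced∈𝐆 {l = suc l} (next a∈ c) l<n with find a∈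
    ... | b , b∈ , a≈b = ∙-closed (𝐆 (suc l)) (resp-≈ (𝐆 (suc l)) (sym a≈b) (leader∈𝐆 l<n b∈))
                           (proj₁ (strict l l<n) (induced∈𝐆 c (ℕ.<⇒≤ l<n)))

    module _ {d P : ℕ → Carrier} (d∈ : ∀ k → d k ∈ˡ toList (leaders k))
             (P-zero : P 0 ≈ ε) (P-suc : ∀ k → P (suc k) ≈ d k ∙ P k) where

      partial-product∈𝐆 : ∀ k → k ≤ℕ n → P k ∈ member (𝐆 k)
      partial-product∈𝐆 zero    _   = resp-≈ (𝐆 0) (sym P-zero) (Subgroup.ε-closed (𝐆 0))
      partial-product∈𝐆 (suc k) k<n = resp-≈ (𝐆 (suc k)) (sym (P-suc k))
        (∙-closed (𝐆 (suc k)) (leader∈𝐆 k<n (d∈ k))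
          (proj₁ (strict k k<n) (partial-product∈𝐆 k (ℕ.<⇒≤ k<n))))

      private
        -- Both `P l` and `x` lie in `𝐆 l`, so the leaders in front of them represent the same
        -- coset, agree, and can be cancelled.
        peel : ∀ {l} → l <ℕ n → ∀ {a x} → Any (a ≈_) (toList (leaders l)) → x ∈ member (𝐆 l) →
               P (suc l) ≈ a ∙ x → P l ≈ x
        peel {l} l<n {a} {x} a∈ x∈ eq with find a∈
        ... | b , b∈ , a≈b = ∙-cancelˡ b _ _ (trans (∙-congʳ (sym dl≈b)) dP≈bx)
          where
          dP≈bx : d l ∙ P l ≈ b ∙ x
          dP≈bx = trans (sym (P-suc l)) (trans eq (∙-congʳ a≈b))
          dl≈b : d l ≈ b
          dl≈b = leader-unique (isLeaders l l<n) (d∈ l) b∈ (partial-product∈𝐆 l (ℕ.<⇒≤ l<n)) x∈ dP≈bx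

      -- Uniqueness of the factorization: the leaders in `c` are peeled off from the left, one level
      -- at a time. For the decoder, this recovers the product of its first `k` choices from a later
      -- product.
      cancel-induced : ∀ {k l c} → c ∈ InducedLeader k l → l ≤ℕ n → ∀ {x} → x ∈ member (𝐆 k) →
                       P l ≈ c ∙ x → P k ≈ x
      cancel-induced (first a∈) l≤n x∈ eq = peel l≤n a∈ x∈ eq
      cancel-induced {l = suc l} (next a∈ c) l<n x∈ eq = cancel-induced c l≤n x∈
        (peel l<n a∈ (∙-closed (𝐆 l) (induced∈𝐆 c l≤n) (𝐆-mono (ℕ.≤⇒≤′ (ℕ.<⇒≤ (induced⇒< c))) l≤n x∈))
          (trans eq (assoc _ _ _)))
        where
        l≤n : l ≤ℕ n
        l≤n = ℕ.<⇒≤ l<n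

    -- The products c_n ⋯ c_{k+1} grown from the right, as the decoder meets
    -- their factors; k = n gives the empty product.
    data Tail : ℕ → Carrier → Set (c ⊔ ℓ) where
      empty : ∀ {k x} → k ≡ n → x ≈ ε → Tail k x
      snoc  : ∀ {k x y a} → Tail (suc k) y → a ∈ˡ toList (leaders k) → x ≈ y ∙ a → Tail k x

    tail⇒≤ : ∀ {k x} → Tail k x → k ≤ℕ n
    tail⇒≤ (empty k≡n _)  = ℕ.≤-reflexive k≡n
    tail⇒≤ (snoc tail _ _) = ℕ.<⇒≤ (tail⇒≤ tail)

    tail-resp-≈ : ∀ {k x y} → x ≈ y → Tail k x → Tail k y
    tail-resp-≈ x≈y (empty k≡n x≈ε)   = empty k≡n (trans (sym x≈y) x≈ε)
    tail-resp-≈ x≈y (snoc tail a∈ eq) = snoc tail a∈ (trans (sym x≈y) eq)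

    -- `InducedLeader` grows on the left, so a new rightmost factor has to be placed under all the
    -- others. The result agrees with `c ∙ a` only up to associativity.
    induced-snoc : ∀ {k l c a} → c ∈ InducedLeader (suc k) l → a ∈ˡ toList (leaders k) →
                   ∃[ x ] x ∈ InducedLeader k l × x ≈ c ∙ a
    induced-snoc (first b∈) a∈ = _ , next b∈ (first (Any.map reflexive a∈)) , refl
    induced-snoc (next b∈ c) a∈ with induced-snoc c a∈
    ... | x , x-induced , x≈ca = _ , next b∈ x-induced , trans (∙-congˡ x≈ca) (sym (assoc _ _ _))

    -- `InducedLeader` contains at least one factor, so the empty tail is kept as a separate case,
    -- and a tail of one factor starts from `first`.
    tail⇒induced : ∀ {k x} → Tail k x → (k ≡ n × x ≈ ε) ⊎ (∃[ y ] y ∈ InducedLeader k n × y ≈ x)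
    tail⇒induced (empty k≡n x≈ε) = inj₁ (k≡n , x≈ε)
    tail⇒induced {k} {x} (snoc {a = a} tail a∈ x≈ya) with tail⇒induced tail
    ... | inj₁ (1+k≡n , y≈ε) = inj₂
      (a , ≡.subst (λ l → a ∈ InducedLeader k l) 1+k≡n (first (Any.map reflexive a∈))
         , sym (trans x≈ya (trans (∙-congʳ y≈ε) (identityˡ a))))
    ... | inj₂ (y , y-induced , y≈) with induced-snoc y-induced a∈
    ...   | z , z-induced , z≈ya = inj₂ (z , z-induced , trans z≈ya (trans (∙-congʳ y≈) (sym x≈ya)))

    -- Descent along the sequence: `complete` splits `g` as a leader times an element of the next
    -- smaller subgroup, and the leader joins the tail. At level 0 the remaining factor is the
    -- identity.
    tail-extend : ∀ {k x g} → Tail k x → g ∈ member (𝐆 k) → Tail 0 (x ∙ g)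
    tail-extend {zero} {x} tail g∈ =
      tail-resp-≈ (sym (trans (∙-congˡ (proj₁ bottom g∈)) (identityʳ x))) tail
    tail-extend {suc k} {x} {g} tail g∈ with find (complete (isLeaders k (tail⇒≤ tail)) g g∈)
    ... | a , a∈ , h , h∈ , g≈ah = tail-resp-≈ (trans (assoc x a h) (∙-congˡ (sym g≈ah)))
                                    (tail-extend (snoc tail a∈ refl) h∈)

    factorization : ∀ {g} → g ∈ member G → Tail 0 g
    factorization {g} g∈G = tail-resp-≈ (identityˡ g) (tail-extend (empty ≡.refl refl) (proj₂ top g∈G))

module _ {ℝ : Reals} {m ℓ} (V : HermitianSpace ℝ m ℓ) where
  open OrderedField ℝ
  open HermitianSpace V
  open InnerProduct V
  open Decoding V
  open LeftModuleMorphisms rawLeftModule rawLeftModule using (module IsLeftModuleIsomorphism)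
  module 𝒰 = Group unitaryGroup
  module 𝒰ₚ = GroupProperties unitaryGroup
  open 𝒰 using (_∙_; ε; _⁻¹) renaming (_≈_ to _≈ᵁ_)
  open Subgroup using (resp-≈; ε-closed; ∙-closed; ⁻¹-closed)

  -- Minimizers over nonempty lists.

  module _ {a} {A : Set a} (f : A → Carrier) where
    -- The comparison function of argmin is local to it, hence only reachable through two-element lists.
    argmin-pair : ∀ x y → (argmin f (x ∷⁺ y ∷ []) ≡ x × f x ≤ f y) ⊎
                          (argmin f (x ∷⁺ y ∷ []) ≡ y × f y ≤ f x)
    argmin-pair x y with f x ≤? f y
    ... | yes fx≤fy = inj₁ (≡.refl , fx≤fy)
    ... | no  fx≰fy = inj₂ (≡.refl , proj₁ (≰⇒> fx≰fy))

    argmin-∈ : ∀ x xs → argmin f (x ∷⁺ xs) ∈ˡ x ∷ xs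
    argmin-∈ x []       = here ≡.refl
    argmin-∈ x (y ∷ ys) with argmin-pair x (argmin f (y ∷⁺ ys))
    ... | inj₁ (eq , _) = here eq
    ... | inj₂ (eq , _) = there (≡.subst (_∈ˡ y ∷ ys) (≡.sym eq) (argmin-∈ y ys))

    argmin-≤ : ∀ x xs {b} → b ∈ˡ x ∷ xs → f (argmin f (x ∷⁺ xs)) ≤ f b
    argmin-≤ x []       (here ≡.refl) = ≤-refl
    argmin-≤ x (y ∷ ys) b∈ with argmin-pair x (argmin f (y ∷⁺ ys))
    ... | inj₁ (eq , fx≤) = ≤-trans (≤-reflexive (reflexive (≡.cong f eq))) (below b∈)
      where
      below : ∀ {b} → b ∈ˡ x ∷ y ∷ ys → f x ≤ f b
      below (here ≡.refl) = ≤-refl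
      below (there b∈)    = ≤-trans fx≤ (argmin-≤ y ys b∈)
    ... | inj₂ (eq , ≤fx) = ≤-trans (≤-reflexive (reflexive (≡.cong f eq))) (below b∈)
      where
      below : ∀ {b} → b ∈ˡ x ∷ y ∷ ys → f (argmin f (y ∷⁺ ys)) ≤ f b
      below (here ≡.refl) = ≤fx
      below (there b∈)    = argmin-≤ y ys b∈

  -- Unitary actions and free orbits.

  ·-cong : ∀ g {x y} → x ≈ᴹ y → g · x ≈ᴹ g · y
  ·-cong g = IsLeftModuleIsomorphism.⟦⟧-cong (Unitary.isIsomorphism g)

  ∙ᵛ-isometric : ∀ g x y → (g · x) ∙ᵛ (g · y) ≈ x ∙ᵛ y
  ∙ᵛ-isometric g x y = proj₁ (Unitary.isometric g x y)

  distance-isometric : ∀ g x y → ‖ g · x -ᵛ g · y ‖ ≤ ‖ x -ᵛ y ‖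
  distance-isometric g x y = ‖‖-mono-≤ (≤-reflexive (trans
    (∙ᵛ-cong g·-minus g·-minus) (∙ᵛ-isometric g (x -ᵛ y) (x -ᵛ y))))
    where
    open IsLeftModuleIsomorphism (Unitary.isIsomorphism g) using (+ᴹ-homo; -ᴹ-homo)
    g·-minus : g · x -ᵛ g · y ≈ᴹ g · (x -ᵛ y)
    g·-minus = ≈ᴹ-sym (≈ᴹ-trans (+ᴹ-homo x (-ᴹ y)) (+ᴹ-congˡ (-ᴹ-homo y)))

  -- Choosing for each orbit point a group element that reaches it gives an injection `pointIndex`
  -- of `Fin n` into itself. It is therefore onto, so every group element is the chosen one for its
  -- point, and elements reaching the same point coincide.
  full-orbit⇒free : ∀ {p} (G : Subgroup p) {x₀} → HasFullOrbit G x₀ → ∀ {g h} →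
                    g ∈ member G → h ∈ member G → g · x₀ ≈ᴹ h · x₀ → g ≈ᵁ h
  full-orbit⇒free G {x₀} (n , elements , points) {g} {h} g∈G h∈G gx₀≈hx₀ =
    begin
    g                        ≈⟨ elementOf-index g∈G ⟨
    elementOf (index g∈G)    ≈⟨ E.cong (index-injective gx₀≈hx₀′) ⟩
    elementOf (index h∈G)    ≈⟨ elementOf-index h∈G ⟩
    h                        ∎
    where
    open SetoidReasoning 𝒰.setoid
    module E = Bijection elements
    module P = Bijection points
    elementOf : Fin n → Unitary
    elementOf i = proj₁ (E.to i)
    index : ∀ {g} → g ∈ member G → Fin n
    index {g} g∈G = proj₁ (E.surjective (g , g∈G))
    elementOf-index : ∀ {g} (g∈G : g ∈ member G) → elementOf (index g∈G) ≈ᵁ g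
    elementOf-index {g} g∈G = proj₂ (E.surjective (g , g∈G)) ≡.refl
    pointIndex : Fin n → Fin n
    pointIndex j = index (proj₁ (proj₂ (proj₂ (P.to j))))
    pointIndex-spec : ∀ j → elementOf (pointIndex j) · x₀ ≈ᴹ proj₁ (P.to j)
    pointIndex-spec j with P.to j
    ... | x , g , g∈G , x≈gx₀ = ≈ᴹ-trans (elementOf-index g∈G x₀) (≈ᴹ-sym x≈gx₀)
    pointIndex-injective : Injective _≡_ _≡_ pointIndex
    pointIndex-injective {j} {k} eq = P.injective (≈ᴹ-trans (≈ᴹ-sym (pointIndex-spec j))
      (≈ᴹ-trans (E.cong eq x₀) (pointIndex-spec k)))
    gx₀≈hx₀′ : elementOf (index g∈G) · x₀ ≈ᴹ elementOf (index h∈G) · x₀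
    gx₀≈hx₀′ = ≈ᴹ-trans (elementOf-index g∈G x₀) (≈ᴹ-trans gx₀≈hx₀ (≈ᴹ-sym (elementOf-index h∈G x₀)))
    index-injective : ∀ {i j} → elementOf i · x₀ ≈ᴹ elementOf j · x₀ → i ≡ j
    index-injective {i} {j} eq
      with injective⇒hit pointIndex-injective i | injective⇒hit pointIndex-injective j
    ... | k , ≡.refl | l , ≡.refl = ≡.cong pointIndex (P.injective
      (≈ᴹ-trans (≈ᴹ-sym (pointIndex-spec k)) (≈ᴹ-trans eq (pointIndex-spec l))))

  -- Scores of group elements and minimality of coset representatives.

  module _ {p} (G : Subgroup p) (x₀ : Vec) (‖x₀‖≈1 : ‖ x₀ ‖ ≈ 1#) (fullOrbit : HasFullOrbit G x₀) where

    score : Unitary → Carrier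
    score g = (g · x₀) ∙ᵛ x₀

    score-cong : ∀ {g h} → g ≈ᵁ h → score g ≈ score h
    score-cong g≈h = ∙ᵛ-cong (g≈h x₀) ≈ᴹ-refl

    x₀∙x₀≈1 : x₀ ∙ᵛ x₀ ≈ 1#
    x₀∙x₀≈1 = trans (sym (‖‖-square x₀)) (trans (*-cong ‖x₀‖≈1 ‖x₀‖≈1) (*-identityˡ 1#))

    free : ∀ {g h} → g ∈ member G → h ∈ member G → g · x₀ ≈ᴹ h · x₀ → g ≈ᵁ h
    free = full-orbit⇒free G fullOrbit

    -- Freeness reduces equality in `G` to equality of the images of `x₀`, which is stable. This
    -- permits identifying the decoder's choice by contradiction.
    ≈ᵁ-stable : ∀ {g h} → g ∈ member G → h ∈ member G → ¬ ¬ (g ≈ᵁ h) → g ≈ᵁ h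
    ≈ᵁ-stable g∈ h∈ ¬g≉h = free g∈ h∈ (≈ᴹ-stable λ gx₀≉hx₀ → ¬g≉h λ g≈h → gx₀≉hx₀ (g≈h x₀))

    -- An enumeration of `G` reduces this to `positive-gap`, since `score` respects equality of
    -- transformations.
    score-gap : ∃[ γ ] 0# < γ × (∀ {g h} → g ∈ member G → h ∈ member G →
                                 score g < score h → score g + γ ≤ score h)
    score-gap = let γ , 0<γ , bound = positive-gap (λ i → score (elementOf i)) in
      γ , 0<γ , λ {g} {h} g∈ h∈ g<h → begin
        score g + γ                       ≈⟨ +-congʳ (score-index g∈) ⟨
        score (elementOf (index g∈)) + γ  ≤⟨ bound (index g∈) (index h∈) (begin-strict
          score (elementOf (index g∈))      ≈⟨ score-index g∈ ⟩
          score g                           <⟨ g<h ⟩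
          score h                           ≈⟨ score-index h∈ ⟨
          score (elementOf (index h∈))      ∎) ⟩
        score (elementOf (index h∈))      ≈⟨ score-index h∈ ⟩
        score h                           ∎
      where
      open Reasoning
      module E = Bijection (proj₁ (proj₂ fullOrbit))
      elementOf : Fin (proj₁ fullOrbit) → Unitary
      elementOf i = proj₁ (E.to i)
      index : ∀ {g} → g ∈ member G → Fin (proj₁ fullOrbit)
      index {g} g∈G = proj₁ (E.surjective (g , g∈G))
      score-index : ∀ {g} (g∈ : g ∈ member G) → score (elementOf (index g∈)) ≈ score g
      score-index {g} g∈ = score-cong {elementOf (index g∈)} {g} (proj₂ (E.surjective (g , g∈)) ≡.refl)

    -- Since the stabilizer of x₀ is trivial, this is minimality of c as a coset representative of H.
    Dominant : Subgroup p → Unitary → Set _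
    Dominant H c = ∀ h → h ∈ member H → ¬ (h ≈ᵁ ε) → score (h ∙ c ⁻¹) < score (c ⁻¹)

    dominant-resp-≈ : ∀ {H c c′} → c ≈ᵁ c′ → Dominant H c → Dominant H c′
    dominant-resp-≈ {c = c} {c′} c≈c′ dom h h∈ h≉ε = begin-strict
      score (h ∙ c′ ⁻¹)  ≈⟨ score-cong {h ∙ c ⁻¹} {h ∙ c′ ⁻¹} (λ x → ·-cong h (c⁻¹≈c′⁻¹ x)) ⟨
      score (h ∙ c ⁻¹)   <⟨ dom h h∈ h≉ε ⟩
      score (c ⁻¹)       ≈⟨ score-cong {c ⁻¹} {c′ ⁻¹} c⁻¹≈c′⁻¹ ⟩
      score (c′ ⁻¹)      ∎
      where
      open Reasoning
      c⁻¹≈c′⁻¹ : c ⁻¹ ≈ᵁ c′ ⁻¹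
      c⁻¹≈c′⁻¹ = 𝒰.⁻¹-cong {c} {c′} c≈c′

    -- By freeness `h` moves `x₀`, and distinct vectors of equal norm have inner product below the
    -- squared norm. This handles the empty tail, which is not an induced leader.
    dominant-ε : ∀ {H c} → member H ⊆ member G → c ≈ᵁ ε → Dominant H c
    dominant-ε {H} {c} H⊆G c≈ε = dominant-resp-≈ {H} {ε} {c} (𝒰.sym {c} {ε} c≈ε) λ h h∈ h≉ε →
      subst-ε h (unequal-∙ᵛ (∙ᵛ-isometric h x₀ x₀) λ hx₀≈x₀ → h≉ε (free (H⊆G h∈) (ε-closed G) hx₀≈x₀))
      where
      subst-ε : ∀ h → score h < score ε → score (h ∙ ε ⁻¹) < score (ε ⁻¹)
      subst-ε h hx₀<x₀ = begin-strict
        score (h ∙ ε ⁻¹)  ≈⟨ ∙ᵛ-cong (·-cong h (𝒰ₚ.ε⁻¹≈ε x₀)) ≈ᴹ-refl ⟩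
        score h           <⟨ hx₀<x₀ ⟩
        score ε           ≈⟨ ∙ᵛ-cong (𝒰ₚ.ε⁻¹≈ε x₀) ≈ᴹ-refl ⟨
        score (ε ⁻¹)      ∎
        where open Reasoning

    -- The point of `FR` sent to `x₀` can only be `(c ⁻¹) · x₀`, and freeness keeps every
    -- nonidentity `h` outside the stabilizer, where `FR` gives strict inequality.
    minimal⇒dominant : ∀ {H c} → member H ⊆ member G → IsMinimal H x₀ c → Dominant H c
    minimal⇒dominant {H} {c} H⊆G (x , x∈FR , x₀≈cx) h h∈ h≉ε = begin-strict
      (h · (c ⁻¹) · x₀) ∙ᵛ x₀  ≈⟨ ∙ᵛ-cong (·-cong h c⁻¹x₀≈x) ≈ᴹ-refl ⟩
      (h · x) ∙ᵛ x₀          <⟨ closer⇒∙ᵛ-< (sym (∙ᵛ-isometric h x x)) (x∈FR h h∈ λ (_ , hx₀≈x₀) →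
                                  h≉ε (free (H⊆G h∈) (ε-closed G) hx₀≈x₀)) ⟩
      x ∙ᵛ x₀                ≈⟨ ∙ᵛ-cong c⁻¹x₀≈x ≈ᴹ-refl ⟨
      ((c ⁻¹) · x₀) ∙ᵛ x₀      ∎
      where
      open Reasoning
      c⁻¹x₀≈x : (c ⁻¹) · x₀ ≈ᴹ x
      c⁻¹x₀≈x = ≈ᴹ-trans (·-cong (c ⁻¹) x₀≈cx) (𝒰.inverseˡ c x)

    dominant⇒minimal : ∀ {H c} → Dominant H c → IsMinimal H x₀ c
    dominant⇒minimal {H} {c} dom = (c ⁻¹) · x₀ , (λ h h∈ h∉Stab →
      ∙ᵛ⇒closer-< (sym (∙ᵛ-isometric h _ _)) (dom h h∈ λ h≈ε → h∉Stab (h∈ , h≈ε x₀)))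
      , ≈ᴹ-sym (𝒰.inverseʳ c x₀)

    -- Behaviour of the subgroup decoder.

    module _ (n : ℕ) (𝒮 : SubgroupSequence G n) where
      open SubgroupSequence 𝒮
      open CosetLeaders unitaryGroup

      choice-∈ : ∀ r k → choice 𝒮 x₀ r k ∈ˡ toList (leaders k)
      choice-∈ r k with leaders k
      ... | a ∷⁺ as = argmin-∈ _ a as

      choice-closest : ∀ r k {a} → a ∈ˡ toList (leaders k) →
                       ‖ residual 𝒮 x₀ r (suc k) -ᵛ x₀ ‖ ≤ ‖ a · residual 𝒮 x₀ r k -ᵛ x₀ ‖
      choice-closest r k a∈ with leaders k
      ... | b ∷⁺ bs = argmin-≤ (λ a → ‖ a · residual 𝒮 x₀ r k -ᵛ x₀ ‖) b bs a∈

      residual≈product : ∀ r k → residual 𝒮 x₀ r k ≈ᴹ product 𝒮 x₀ r k · r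
      residual≈product r zero    = ≈ᴹ-refl
      residual≈product r (suc k) = ·-cong (choice 𝒮 x₀ r k) (residual≈product r k)

      -- By `has-ε`, leaving the residual where it is competes at every step, so the chosen leader
      -- does at least as well.
      residual-descends : ∀ r k → k ≤ℕ n → ‖ residual 𝒮 x₀ r k -ᵛ x₀ ‖ ≤ ‖ r -ᵛ x₀ ‖
      residual-descends r zero    _   = ≤-refl
      residual-descends r (suc k) k<n with find (IsCosetLeaders.has-ε (isLeaders k k<n))
      ... | a , a∈ , ε≈a = ≤-trans (choice-closest r k a∈)
        (≤-trans (distance-congˡ (≈ᴹ-sym (ε≈a (residual 𝒮 x₀ r k)))) (residual-descends r k (ℕ.<⇒≤ k<n)))

      decodes⇒minimal : DecodesWithSomeNoise 𝒮 x₀ → AllInducedLeadersMinimal 𝒮 x₀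
      decodes⇒minimal (δ , 0<δ , decodes) k k<n c c-induced =
        dominant⇒minimal {𝐆 k} {c} λ h h∈ h≉ε → dominant h h∈ h≉ε
        where
        dominant : Dominant (𝐆 k) c
        dominant h h∈ h≉ε = begin-strict
          -- The weak inequality on a whole ball becomes strict at its centre because `h` moves
          -- `x₀`.
          (h · (c ⁻¹) · x₀) ∙ᵛ x₀        <⟨ locally-≤⇒< x₀≉hx₀ 0<δ locally-≤ ⟩
          (h · (c ⁻¹) · x₀) ∙ᵛ (h · x₀)  ≈⟨ ∙ᵛ-isometric h ((c ⁻¹) · x₀) x₀ ⟩
          ((c ⁻¹) · x₀) ∙ᵛ x₀            ∎
          where
          open Reasoning
          g : Unitary
          -- Chosen so that the codeword of `g` is `h · (c ⁻¹) · x₀` and the part of `g` in `𝐆 k` is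
          -- `h ⁻¹`.
          g = c ∙ h ⁻¹
          h∈G : h ∈ member G
          h∈G = 𝐆⊆G 𝒮 (ℕ.<⇒≤ k<n) h∈
          h⁻¹∈ : h ⁻¹ ∈ member (𝐆 k)
          h⁻¹∈ = ⁻¹-closed (𝐆 k) h∈
          g∈G : g ∈ member G
          g∈G = ∙-closed G (𝐆⊆G 𝒮 ℕ.≤-refl (induced∈𝐆 𝒮 c-induced ℕ.≤-refl)) (⁻¹-closed G h∈G)
          x₀≉hx₀ : ¬ (x₀ ≈ᴹ h · x₀)
          x₀≉hx₀ x₀≈hx₀ = h≉ε (free h∈G (ε-closed G) (≈ᴹ-sym x₀≈hx₀))
          g⁻¹≈ : g ⁻¹ ≈ᵁ h ∙ c ⁻¹
          g⁻¹≈ x = ≈ᴹ-trans (𝒰ₚ.⁻¹-anti-homo-∙ c (h ⁻¹) x) (𝒰ₚ.⁻¹-involutive h ((c ⁻¹) · x))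
          locally-≤ : ∀ r → ‖ r -ᵛ h · (c ⁻¹) · x₀ ‖ < δ → r ∙ᵛ x₀ ≤ r ∙ᵛ (h · x₀)
          locally-≤ r near = begin
            r ∙ᵛ x₀                     ≤⟨ closer⇒∙ᵛ (∙ᵛ-isometric (h ⁻¹) r r) h⁻¹r-closer ⟩
            ((h ⁻¹) · r) ∙ᵛ x₀            ≈⟨ ∙ᵛ-isometric h ((h ⁻¹) · r) x₀ ⟨
            (h · (h ⁻¹) · r) ∙ᵛ (h · x₀)  ≈⟨ ∙ᵛ-cong (𝒰.inverseʳ h r) ≈ᴹ-refl ⟩
            r ∙ᵛ (h · x₀)               ∎
            where
            decoded : product 𝒮 x₀ r n ≈ᵁ g
            decoded with decodes g g∈G r (begin-strict
                ‖ r -ᵛ (g ⁻¹) · x₀ ‖      ≤⟨ ‖‖-cong (+ᴹ-congˡ (-ᴹ‿cong (g⁻¹≈ x₀))) ⟩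
                ‖ r -ᵛ h · (c ⁻¹) · x₀ ‖  <⟨ near ⟩
                δ                       ∎)
            -- The decoder is correct only up to a stabilizer element `s`, which freeness turns into
            -- the identity.
            ... | s , (s∈G , sx₀≈x₀) , eq = λ x → ≈ᴹ-trans (eq x) (free s∈G (ε-closed G) sx₀≈x₀ (g · x))
            product≈h⁻¹ : product 𝒮 x₀ r k ≈ᵁ h ⁻¹
            product≈h⁻¹ = cancel-induced 𝒮 {choice 𝒮 x₀ r} {product 𝒮 x₀ r} (choice-∈ r)
              (λ _ → ≈ᴹ-refl) (λ _ _ → ≈ᴹ-refl) c-induced ℕ.≤-refl {h ⁻¹} h⁻¹∈ decoded
            h⁻¹r-closer : ‖ (h ⁻¹) · r -ᵛ x₀ ‖ ≤ ‖ r -ᵛ x₀ ‖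
            h⁻¹r-closer = begin
              ‖ (h ⁻¹) · r -ᵛ x₀ ‖
                ≤⟨ distance-congˡ (≈ᴹ-sym (≈ᴹ-trans (residual≈product r k) (product≈h⁻¹ r))) ⟩
              ‖ residual 𝒮 x₀ r k -ᵛ x₀ ‖ ≤⟨ residual-descends r k (ℕ.<⇒≤ k<n) ⟩
              ‖ r -ᵛ x₀ ‖                 ∎

      -- The hypothesis covers nonempty products; `dominant-ε` adds the empty one, which is needed
      -- at the decoder's last step.
      tail-dominant : AllInducedLeadersMinimal 𝒮 x₀ → ∀ {k c} → Tail 𝒮 k c → Dominant (𝐆 k) c
      tail-dominant minimal {k} {c} tail with tail⇒induced 𝒮 tail
      ... | inj₁ (_ , c≈ε) = dominant-ε {𝐆 k} {c} (𝐆⊆G 𝒮 (tail⇒≤ 𝒮 tail)) c≈ε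
      ... | inj₂ (d , d-induced , d≈c) = dominant-resp-≈ {𝐆 k} {d} {c} d≈c
        (minimal⇒dominant {𝐆 k} {d} (𝐆⊆G 𝒮 (tail⇒≤ 𝒮 tail))
          (minimal k (induced⇒< 𝒮 d-induced) d d-induced))

      tail∈G : ∀ {k c} → Tail 𝒮 k c → c ∈ member G
      tail∈G {k} {c} (empty _ c≈ε) = resp-≈ G {ε} {c} (𝒰.sym {c} {ε} c≈ε) (ε-closed G)
      tail∈G {k} {c} (snoc {y = y} {a} tail a∈ c≈ya) = resp-≈ G {y ∙ a} {c} (𝒰.sym {c} {y ∙ a} c≈ya)
        (∙-closed G (tail∈G tail) (𝐆⊆G 𝒮 (tail⇒≤ 𝒮 tail) (leader∈𝐆 𝒮 (tail⇒≤ 𝒮 tail) a∈)))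

      minimal⇒decodes : AllInducedLeadersMinimal 𝒮 x₀ → DecodesWithSomeNoise 𝒮 x₀
      minimal⇒decodes minimal with score-gap
      ... | γ , 0<γ , gap with midpoint 0<γ
      -- Noise can favour a wrong candidate and penalize the right one, each by less than `δ`, so
      -- twice `δ` must fit into the gap.
      ...   | δ , 0<δ , δ+δ≈γ = δ , 0<δ , decodes
        where
        decodes : ∀ g → g ∈ member G → ∀ r → ‖ r -ᵛ (g ⁻¹) · x₀ ‖ < δ →
                  decode 𝒮 x₀ r ∈ RightCoset (Stab G x₀) g
        decodes g g∈G r near with progress n ℕ.≤-refl
          where
          P : ℕ → Unitary
          P = product 𝒮 x₀ r

          -- Applied to the transformed codeword `q`, the leader `a` gives `(y ⁻¹) · x₀`, whereas a
          -- different choice `d` gives `h · (y ⁻¹) · x₀` with `h` a nonidentity element of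
          -- `𝐆 (suc k)`. Dominance of `y` and the score gap separate the two.
          choice-correct : ∀ {k y a} → k <ℕ n → Tail 𝒮 (suc k) y → a ∈ˡ toList (leaders k) →
                           g ≈ᵁ (y ∙ a) ∙ P k → choice 𝒮 x₀ r k ≈ᵁ a
          choice-correct {k} {y} {a} k<n tail a∈ g≈yaP = ≈ᵁ-stable (𝐆⊆G 𝒮 k<n d∈) (𝐆⊆G 𝒮 k<n a∈𝐆) λ d≉a →
            <⇒≱ (worse d≉a) (closer⇒∙ᵛ
              (trans (∙ᵛ-isometric d s s) (sym (∙ᵛ-isometric a s s))) (choice-closest r k a∈))
            where
            open Reasoning
            d h : Unitary
            d = choice 𝒮 x₀ r k
            h = d ∙ a ⁻¹
            s q : Vec
            s = residual 𝒮 x₀ r k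
            -- The codeword carried along by the choices made for `r`; isometry keeps the residual
            -- within `δ` of it.
            q = P k · (g ⁻¹) · x₀
            d∈ : d ∈ member (𝐆 (suc k))
            d∈ = leader∈𝐆 𝒮 k<n (choice-∈ r k)
            a∈𝐆 : a ∈ member (𝐆 (suc k))
            a∈𝐆 = leader∈𝐆 𝒮 k<n a∈
            h∈ : h ∈ member (𝐆 (suc k))
            h∈ = ∙-closed (𝐆 (suc k)) d∈ (⁻¹-closed (𝐆 (suc k)) a∈𝐆)
            y⁻¹∈ : y ⁻¹ ∈ member G
            y⁻¹∈ = ⁻¹-closed G (tail∈G tail)
            aq≈ : a · q ≈ᴹ (y ⁻¹) · x₀
            aq≈ = ≈ᴹ-trans (≈ᴹ-sym (𝒰.inverseˡ y (a · q)))
              (·-cong (y ⁻¹) (≈ᴹ-trans (≈ᴹ-sym (g≈yaP ((g ⁻¹) · x₀))) (𝒰.inverseʳ g x₀)))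
            dq≈ : d · q ≈ᴹ h · (y ⁻¹) · x₀
            dq≈ = ·-cong d (≈ᴹ-trans (≈ᴹ-sym (𝒰.inverseˡ a q)) (·-cong (a ⁻¹) aq≈))
            s-near-q : ‖ s -ᵛ q ‖ < δ
            s-near-q = begin-strict
              ‖ s -ᵛ q ‖                          ≤⟨ distance-congˡ (residual≈product r k) ⟩
              ‖ P k · r -ᵛ P k · (g ⁻¹) · x₀ ‖      ≤⟨ distance-isometric (P k) r ((g ⁻¹) · x₀) ⟩
              ‖ r -ᵛ (g ⁻¹) · x₀ ‖                  <⟨ near ⟩
              δ                                   ∎
            worse : ¬ (d ≈ᵁ a) → (d · s) ∙ᵛ x₀ < (a · s) ∙ᵛ x₀
            -- One `δ` pays for replacing `d · s` by `d · q`, the other for replacing `a · q` by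
            -- `a · s`.
            worse d≉a = +-cancelʳ-< δ (begin-strict
              (d · s) ∙ᵛ x₀ + δ              <⟨ +-monoˡ-< δ (near⇒∙ᵛ-< x₀∙x₀≈1 (begin-strict
                ‖ d · s -ᵛ d · q ‖             ≤⟨ distance-isometric d s q ⟩
                ‖ s -ᵛ q ‖                     <⟨ s-near-q ⟩
                δ                              ∎)) ⟩
              (d · q) ∙ᵛ x₀ + δ + δ          ≈⟨ trans (+-assoc _ δ δ) (+-cong (∙ᵛ-cong dq≈ ≈ᴹ-refl) δ+δ≈γ) ⟩
              score (h ∙ y ⁻¹) + γ           ≤⟨ gap (∙-closed G (𝐆⊆G 𝒮 k<n h∈) y⁻¹∈) y⁻¹∈
                                                  (tail-dominant minimal tail h h∈ h≉ε) ⟩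
              score (y ⁻¹)                   ≈⟨ ∙ᵛ-cong aq≈ ≈ᴹ-refl ⟨
              (a · q) ∙ᵛ x₀                  <⟨ near⇒∙ᵛ-< x₀∙x₀≈1 (begin-strict
                ‖ a · q -ᵛ a · s ‖             ≤⟨ distance-isometric a q s ⟩
                ‖ q -ᵛ s ‖                     ≤⟨ ‖x-y‖≤‖y-x‖ q s ⟩
                ‖ s -ᵛ q ‖                     <⟨ s-near-q ⟩
                δ                              ∎) ⟩
              (a · s) ∙ᵛ x₀ + δ              ∎)
              where
              h≉ε : ¬ (h ≈ᵁ ε)
              h≉ε h≈ε = d≉a (𝒰ₚ.x∙y⁻¹≈ε⇒x≈y d a h≈ε)

          -- The loop invariant: the tail holds the factors of `g` still to be found. Each correct
          -- choice moves its rightmost factor into `P`.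
          progress : ∀ k → k ≤ℕ n → ∃[ c ] Tail 𝒮 k c × g ≈ᵁ c ∙ P k
          progress zero    _   = g , factorization 𝒮 g∈G , λ _ → ≈ᴹ-refl
          progress (suc k) k<n with progress k (ℕ.<⇒≤ k<n)
          ... | c , empty k≡n _ , _ = contradiction k≡n (ℕ.<⇒≢ k<n)
          ... | c , snoc {y = y} {a} tail a∈ c≈ya , g≈cP = y , tail , λ x →
                ≈ᴹ-trans (g≈yaP x) (·-cong y (≈ᴹ-sym (choice-correct k<n tail a∈ g≈yaP (P k · x))))
            where
            g≈yaP : g ≈ᵁ (y ∙ a) ∙ P k
            g≈yaP x = ≈ᴹ-trans (g≈cP x) (c≈ya (P k · x))
        -- A further factor at level `n` would require a tail at level `suc n`, beyond the end of
        -- the sequence.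
        ... | c , snoc tail _ _ , _    = contradiction (tail⇒≤ 𝒮 tail) ℕ.1+n≰n
        -- With no factors left the output equals `g` itself, so `ε` serves as the stabilizer
        -- element.
        ... | c , empty _ c≈ε , g≈cP = ε , (ε-closed G , ≈ᴹ-refl) , λ x →
              ≈ᴹ-sym (≈ᴹ-trans (g≈cP x) (c≈ε (product 𝒮 x₀ r n · x)))

theoremA : ∀ {m ℓ p} (ℝ : Reals) (V : HermitianSpace ℝ m ℓ) →
    let open Reals ℝ
        open HermitianSpace V
        open Decoding V
    in (G : Subgroup p) → IsFinite G →
       (x₀ : Vec) → ‖ x₀ ‖ ≈ 1# → HasFullOrbit G x₀ →
       (n : ℕ) (𝒮 : SubgroupSequence G n) →
       DecodesWithSomeNoise 𝒮 x₀ ⇔ AllInducedLeadersMinimal 𝒮 x₀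
theoremA ℝ V G _ x₀ ‖x₀‖≈1 fullOrbit n 𝒮 =
  mk⇔ (decodes⇒minimal V G x₀ ‖x₀‖≈1 fullOrbit n 𝒮) (minimal⇒decodes V G x₀ ‖x₀‖≈1 fullOrbit n 𝒮)
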